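{- Let $\mathcal S$, $\mathcal A\subseteq\mathcal S^2$, $\mathcal R\subseteq\mathcal S^3$ be given. The PTSC determined by $(\mathcal S,\mathcal A,\mathcal R)$ is strongly normalising (every ground term $M$ with $\Gamma\vdash M:A$ for some $\Gamma,A$ admits no infinite $\to$-reduction sequence) if and only if the PTS determined by the same $(\mathcal S,\mathcal A,\mathcal R)$ is strongly normalising (every PTS term $t$ with $\Gamma\vdash_{\mathsf{PTS}}t:T$ for some $\Gamma,T$ admits no infinite $\to_\beta$-reduction sequence).
   Context: Ground PTSC syntax: given sorts $\mathcal S$ and variables, terms $M ::= \Pi x^{A}.B \mid \lambda x^{A}.M \mid s \mid x\,l \mid M\,l \mid \langle N/x\rangle_A M$ and lists $l ::= [\,] \mid M\cdot l \mid l @ l' \mid \langle N/x\rangle_A l$ ($\langle N/x\rangle_A$ explicit substitution binding $x$; $\Pi,\lambda$ bind $x$). Reduction $\to$ is the contextual closure of: $(\lambda x^A.M)(N\cdot l)\to(\langle N/x\rangle_A M)\,l$; $M\,[\,]\to M$; $(x\,l)\,l'\to x\,(l@l')$; $(M\,l)\,l'\to M\,(l@l')$; $(M\cdot l')@l\to M\cdot(l'@l)$; $[\,]@l\to l$; $(l@l')@l''\to l@(l'@l'')$; $l@[\,]\to l$; $\langle P/y\rangle_G(\lambda x^A.M)\to\lambda x^{\langle P/y\rangle_G A}.\langle P/y\rangle_G M$; $\langle P/y\rangle_G(y\,l)\to P\,(\langle P/y\rangle_G l)$; $\langle P/y\rangle_G(x\,l)\to x\,(\langle P/y\rangle_G l)$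 ($x\ne y$); $\langle P/y\rangle_G(M\,l)\to(\langle P/y\rangle_G M)(\langle P/y\rangle_G l)$; $\langle P/y\rangle_G(\Pi x^A.B)\to\Pi x^{\langle P/y\rangle_G A}.\langle P/y\rangle_G B$; $\langle P/y\rangle_G s\to s$; $\langle P/y\rangle_G[\,]\to[\,]$; $\langle P/y\rangle_G(M\cdot l)\to(\langle P/y\rangle_G M)\cdot(\langle P/y\rangle_G l)$; $\langle P/y\rangle_G(l@l')\to(\langle P/y\rangle_G l)@(\langle P/y\rangle_G l')$; $\leftrightarrow^*$ is the induced equivalence. PTSC typing (parameters $\mathcal A$, $\mathcal R$): environments are lists of $(x:A)$; $\langle P/x\rangle_A\Delta$ applies the substitution to every type of $\Delta$; $\Gamma\sqsubseteq\Delta$ means each $(x:A)\in\Gamma$ has some $(x:B)\in\Delta$ with $A\leftrightarrow^*B$. Rules: $\emptyset\ \mathsf{wf}$; $\Gamma\vdash A:s$, $x\notin\mathrm{dom}\,\Gamma\Rightarrow\Gamma,(x:A)\ \mathsf{wf}$; $\Gamma\ \mathsf{wf}$, $(s,s')\in\mathcal A\Rightarrow\Gamma\vdash s:s'$; $\Gamma\vdash A:s_1$, $\Gamma,(x:A)\vdash B:s_2$, $(s_1,s_2,s_3)\in\mathcal R\Rightarrow\Gamma\vdash\Pi x^A.B:s_3$; $\Gamma\vdash\Pi x^A.B:s$, $\Gamma,(x:A)\vdash M:B\Rightarrow\Gamma\vdash\lambda x^A.M:\Pi x^A.B$; $\Gamma;A\vdash l:B$, $(x:A)\in\Gamma\Rightarrow\Gamma\vdash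 x\,l:B$; $\Gamma\vdash A:s\Rightarrow\Gamma;A\vdash[\,]:A$; $\Gamma\vdash M:A$, $\Gamma\vdash B:s$, $A\leftrightarrow^*B\Rightarrow\Gamma\vdash M:B$; $\Gamma\vdash\Pi x^A.B:s$, $\Gamma\vdash M:A$, $\Gamma;\langle M/x\rangle_A B\vdash l:C\Rightarrow\Gamma;\Pi x^A.B\vdash M\cdot l:C$; $\Gamma;C\vdash l:A$, $\Gamma\vdash B:s$, $A\leftrightarrow^*B\Rightarrow\Gamma;C\vdash l:B$; $\Gamma;A\vdash l:C$, $\Gamma\vdash B:s$, $A\leftrightarrow^*B\Rightarrow\Gamma;B\vdash l:C$; $\Gamma;C\vdash l':A$, $\Gamma;A\vdash l:B\Rightarrow\Gamma;C\vdash l'@l:B$; $\Gamma\vdash P:A$, $\Gamma,(x:A),\Delta;B\vdash l:C$, $\Gamma,\langle P/x\rangle_A\Delta\sqsubseteq\Delta'$, $\Delta'\ \mathsf{wf}\Rightarrow\Delta';\langle P/x\rangle_A B\vdash\langle P/x\rangle_A l:\langle P/x\rangle_A C$; $\Gamma\vdash M:A$, $\Gamma;A\vdash l:B\Rightarrow\Gamma\vdash M\,l:B$; $\Gamma\vdash P:A$, $\Gamma,(x:A),\Delta\vdash M:C$, $\Gamma,\langle P/x\rangle_A\Delta\sqsubseteq\Delta'$, $\Delta'\ \mathsf{wf}\Rightarrow\Delta'\vdash\langle P/x\rangle_A M:C'$ with $C'=C$ if $C\in\mathcal S$, else $C'=\langle P/x\rangle_A C$. PTS: terms $t,u,T,U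 ::= x\mid s\mid\Pi x^T.t\mid\lambda x^T.t\mid t\,u$, $\to_\beta$ the contextual closure of $(\lambda x^v.t)u\to t\{x:=u\}$, $\leftrightarrow_\beta^*$ its equivalence. PTS typing rules (same $\mathcal S,\mathcal A,\mathcal R$): $\emptyset\ \mathsf{wf}$; $\Gamma\vdash_{\mathsf{PTS}}T:s$, $x\notin\mathrm{dom}\,\Gamma\Rightarrow\Gamma,(x:T)\ \mathsf{wf}$; $\Gamma\ \mathsf{wf}$, $(x:T)\in\Gamma\Rightarrow\Gamma\vdash_{\mathsf{PTS}}x:T$; $\Gamma\ \mathsf{wf}$, $(s,s')\in\mathcal A\Rightarrow\Gamma\vdash_{\mathsf{PTS}}s:s'$; $\Gamma\vdash_{\mathsf{PTS}}U:s_1$, $\Gamma,(x:U)\vdash_{\mathsf{PTS}}T:s_2$, $(s_1,s_2,s_3)\in\mathcal R\Rightarrow\Gamma\vdash_{\mathsf{PTS}}\Pi x^U.T:s_3$; $\Gamma\vdash_{\mathsf{PTS}}\Pi x^U.T:s$, $\Gamma,(x:U)\vdash_{\mathsf{PTS}}t:T\Rightarrow\Gamma\vdash_{\mathsf{PTS}}\lambda x^U.t:\Pi x^U.T$; $\Gamma\vdash_{\mathsf{PTS}}t:\Pi x^U.T$, $\Gamma\vdash_{\mathsf{PTS}}u:U\Rightarrow\Gamma\vdash_{\mathsf{PTS}}t\,u:T\{x:=u\}$; $\Gamma\vdash_{\mathsf{PTS}}t:U$, $\Gamma\vdash_{\mathsf{PTS}}V:s$, $U\leftrightarrow_\beta^*V\Rightarrow\Gamma\vdash_{\mathsf{PTS}}t:V$.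 -}

module Defs where

-- Pure Type Systems (PTS) and Pure Type Sequent Calculi (PTSC).
-- Syntax is locally nameless: free variables are names (ℕ), bound
-- variables are de Bruijn indices (this represents terms modulo α).

open import Data.Nat using (ℕ; zero; suc; pred; _<ᵇ_; _≡ᵇ_)
open import Data.Nat.Properties using (<-cmp)
open import Data.Bool using (if_then_else_)
open import Data.List using (List; []; _∷_; _++_)
open import Data.List.Membership.Propositional using (_∉_)
open import Data.Product using (_×_; ∃)
open import Relation.Binary.Definitions using (tri<; tri≈; tri>)
open import Relation.Binary.Construct.Closure.Equivalence using (EqClosure)
open import Induction.WellFounded using (Acc)

Name : Set
Name = ℕ

module PTSC (S : Set) (Ax : S → S → Set) (Rl : S → S → S → Set) where

  data Tm : Set
  data Ls : Set

  data Tm where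
    pi   : Tm → Tm → Tm          -- Π x^A. B   (B binds index 0)
    lam  : Tm → Tm → Tm          -- λ x^A. M   (M binds index 0)
    srt  : S → Tm
    fvar : Name → Ls → Tm
    bvar : ℕ → Ls → Tm
    app  : Tm → Ls → Tm
    esub : Tm → Tm → Tm → Tm     -- ⟨N/x⟩_A M : esub N A M (M binds index 0)

  data Ls where
    nil  : Ls
    cons : Tm → Ls → Ls
    cat  : Ls → Ls → Ls
    lsub : Tm → Tm → Ls → Ls     -- ⟨N/x⟩_A l : lsub N A l (l binds index 0)

  module Trav (bv : ℕ → ℕ → Ls → Tm) (fv : ℕ → Name → Ls → Tm) where
    travT : ℕ → Tm → Tm
    travL : ℕ → Ls → Ls
    travT k (pi A B)     = pi (travT k A) (travT (suc k) B)
    travT k (lam A M)    = lam (travT k A) (travT (suc k) M)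
    travT k (srt s)      = srt s
    travT k (fvar x l)   = fv k x (travL k l)
    travT k (bvar i l)   = bv k i (travL k l)
    travT k (app M l)    = app (travT k M) (travL k l)
    travT k (esub P A M) = esub (travT k P) (travT k A) (travT (suc k) M)
    travL k nil          = nil
    travL k (cons M l)   = cons (travT k M) (travL k l)
    travL k (cat l l')   = cat (travL k l) (travL k l')
    travL k (lsub P A l) = lsub (travT k P) (travT k A) (travL (suc k) l)

  keepF : ℕ → Name → Ls → Tm
  keepF _ x l = fvar x l

  shiftT : ℕ → Tm → Tm
  shiftT = Trav.travT (λ k i l → bvar (if i <ᵇ k then i else suc i) l) keepF

  swapIx : ℕ → ℕ → ℕ
  swapIx k i = if i ≡ᵇ k then suc k else (if i ≡ᵇ suc k then k else i)

  swapT : ℕ → Tm → Tm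
  swapT = Trav.travT (λ k i l → bvar (swapIx k i) l) keepF

  openT : Name → Tm → Tm
  openT x = Trav.travT (λ k i l → if i ≡ᵇ k then fvar x l else bvar i l) keepF 0

  closeF : Name → ℕ → Name → Ls → Tm
  closeF x k y l = if y ≡ᵇ x then bvar k l else fvar y l

  closeT : Name → Tm → Tm
  closeT x = Trav.travT (λ _ i l → bvar i l) (closeF x) 0

  closeL : Name → Ls → Ls
  closeL x = Trav.travL (λ _ i l → bvar i l) (closeF x) 0

  fvT : Tm → List Name
  fvL : Ls → List Name
  fvT (pi A B)     = fvT A ++ fvT B
  fvT (lam A M)    = fvT A ++ fvT M
  fvT (srt s)      = []
  fvT (fvar x l)   = x ∷ fvL l
  fvT (bvar i l)   = fvL l
  fvT (app M l)    = fvT M ++ fvL l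
  fvT (esub P A M) = fvT P ++ fvT A ++ fvT M
  fvL nil          = []
  fvL (cons M l)   = fvT M ++ fvL l
  fvL (cat l l')   = fvL l ++ fvL l'
  fvL (lsub P A l) = fvT P ++ fvT A ++ fvL l

  esubN : Tm → Tm → Name → Tm → Tm
  esubN P A x M = esub P A (closeT x M)

  lsubN : Tm → Tm → Name → Ls → Ls
  lsubN P A x l = lsub P A (closeL x l)

  infix 4 _⟶t_ _⟶l_
  data _⟶t_ : Tm → Tm → Set
  data _⟶l_ : Ls → Ls → Set

  data _⟶t_ where
    r-beta   : ∀ {A M N l} → app (lam A M) (cons N l) ⟶t app (esub N A M) l
    r-nil    : ∀ {M} → app M nil ⟶t M
    r-fvar   : ∀ {x l l'} → app (fvar x l) l' ⟶t fvar x (cat l l')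
    r-bvar   : ∀ {i l l'} → app (bvar i l) l' ⟶t bvar i (cat l l')
    r-app    : ∀ {M l l'} → app (app M l) l' ⟶t app M (cat l l')
    r-s-lam  : ∀ {P G A M} → esub P G (lam A M) ⟶t
                 lam (esub P G A) (esub (shiftT 0 P) (shiftT 0 G) (swapT 0 M))
    r-s-hit  : ∀ {P G l} → esub P G (bvar 0 l) ⟶t app P (lsub P G l)
    r-s-bvar : ∀ {P G i l} → esub P G (bvar (suc i) l) ⟶t bvar i (lsub P G l)
    r-s-fvar : ∀ {P G x l} → esub P G (fvar x l) ⟶t fvar x (lsub P G l)
    r-s-app  : ∀ {P G M l} → esub P G (app M l) ⟶t app (esub P G M) (lsub P G l)
    r-s-pi   : ∀ {P G A B} → esub P G (pi A B) ⟶t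
                 pi (esub P G A) (esub (shiftT 0 P) (shiftT 0 G) (swapT 0 B))
    r-s-srt  : ∀ {P G s} → esub P G (srt s) ⟶t srt s
    c-pi₁   : ∀ {A A' B} → A ⟶t A' → pi A B ⟶t pi A' B
    c-pi₂   : ∀ {A B B'} → B ⟶t B' → pi A B ⟶t pi A B'
    c-lam₁  : ∀ {A A' M} → A ⟶t A' → lam A M ⟶t lam A' M
    c-lam₂  : ∀ {A M M'} → M ⟶t M' → lam A M ⟶t lam A M'
    c-fvar  : ∀ {x l l'} → l ⟶l l' → fvar x l ⟶t fvar x l'
    c-bvar  : ∀ {i l l'} → l ⟶l l' → bvar i l ⟶t bvar i l'
    c-app₁  : ∀ {M M' l} → M ⟶t M' → app M l ⟶t app M' l
    c-app₂  : ∀ {M l l'} → l ⟶l l' → app M l ⟶t app M l'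
    c-esub₁ : ∀ {P P' A M} → P ⟶t P' → esub P A M ⟶t esub P' A M
    c-esub₂ : ∀ {P A A' M} → A ⟶t A' → esub P A M ⟶t esub P A' M
    c-esub₃ : ∀ {P A M M'} → M ⟶t M' → esub P A M ⟶t esub P A M'

  data _⟶l_ where
    r-cat-cons : ∀ {M l' l} → cat (cons M l') l ⟶l cons M (cat l' l)
    r-cat-nil  : ∀ {l} → cat nil l ⟶l l
    r-cat-cat  : ∀ {l l' l''} → cat (cat l l') l'' ⟶l cat l (cat l' l'')
    r-cat-nilr : ∀ {l} → cat l nil ⟶l l
    r-s-nil    : ∀ {P G} → lsub P G nil ⟶l nil
    r-s-cons   : ∀ {P G M l} → lsub P G (cons M l) ⟶l cons (esub P G M) (lsub P G l)
    r-s-cat    : ∀ {P G l l'} → lsub P G (cat l l') ⟶l cat (lsub P G l) (lsub P G l')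
    c-cons₁ : ∀ {M M' l} → M ⟶t M' → cons M l ⟶l cons M' l
    c-cons₂ : ∀ {M l l'} → l ⟶l l' → cons M l ⟶l cons M l'
    c-cat₁  : ∀ {l₁ l₁' l₂} → l₁ ⟶l l₁' → cat l₁ l₂ ⟶l cat l₁' l₂
    c-cat₂  : ∀ {l₁ l₂ l₂'} → l₂ ⟶l l₂' → cat l₁ l₂ ⟶l cat l₁ l₂'
    c-lsub₁ : ∀ {P P' A l} → P ⟶t P' → lsub P A l ⟶l lsub P' A l
    c-lsub₂ : ∀ {P A A' l} → A ⟶t A' → lsub P A l ⟶l lsub P A' l
    c-lsub₃ : ∀ {P A l l'} → l ⟶l l' → lsub P A l ⟶l lsub P A l'

  infix 4 _↔*_
  _↔*_ : Tm → Tm → Set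
  _↔*_ = EqClosure _⟶t_

  infixl 5 _▸_⦂_
  data Ctx : Set where
    ε     : Ctx
    _▸_⦂_ : Ctx → Name → Tm → Ctx

  infixl 4 _⧺_
  _⧺_ : Ctx → Ctx → Ctx
  Γ ⧺ ε           = Γ
  Γ ⧺ (Δ ▸ x ⦂ A) = (Γ ⧺ Δ) ▸ x ⦂ A

  dom : Ctx → List Name
  dom ε           = []
  dom (Γ ▸ x ⦂ A) = x ∷ dom Γ

  infix 4 _⦂_∈_
  data _⦂_∈_ : Name → Tm → Ctx → Set where
    here  : ∀ {Γ x A} → x ⦂ A ∈ (Γ ▸ x ⦂ A)
    there : ∀ {Γ x A y B} → x ⦂ A ∈ Γ → x ⦂ A ∈ (Γ ▸ y ⦂ B)

  substCtx : Tm → Tm → Name → Ctx → Ctx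
  substCtx P A x ε           = ε
  substCtx P A x (Δ ▸ y ⦂ B) = substCtx P A x Δ ▸ y ⦂ esubN P A x B

  infix 4 _⊑_
  _⊑_ : Ctx → Ctx → Set
  Γ ⊑ Δ = ∀ {x A} → x ⦂ A ∈ Γ → ∃ λ B → (x ⦂ B ∈ Δ) × (A ↔* B)

  substTy : Tm → Tm → Name → Tm → Tm
  substTy P A x (srt s) = srt s
  substTy P A x C       = esubN P A x C

  infix 3 _⊢_∶_ _∣_⊢ₗ_∶_
  data Wf : Ctx → Set
  data _⊢_∶_ : Ctx → Tm → Tm → Set
  data _∣_⊢ₗ_∶_ : Ctx → Tm → Ls → Tm → Set

  data Wf where
    wf-ε   : Wf ε
    wf-ext : ∀ {Γ x A s} → Γ ⊢ A ∶ srt s → x ∉ dom Γ → Wf (Γ ▸ x ⦂ A)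

  data _⊢_∶_ where
    t-sort : ∀ {Γ s s'} → Wf Γ → Ax s s' → Γ ⊢ srt s ∶ srt s'
    t-pi   : ∀ {Γ A B x s₁ s₂ s₃} →
             Γ ⊢ A ∶ srt s₁ → x ∉ fvT B → (Γ ▸ x ⦂ A) ⊢ openT x B ∶ srt s₂ →
             Rl s₁ s₂ s₃ → Γ ⊢ pi A B ∶ srt s₃
    t-lam  : ∀ {Γ A B M x s} →
             Γ ⊢ pi A B ∶ srt s → x ∉ fvT M → x ∉ fvT B →
             (Γ ▸ x ⦂ A) ⊢ openT x M ∶ openT x B → Γ ⊢ lam A M ∶ pi A B
    t-var  : ∀ {Γ A B l x} → Γ ∣ A ⊢ₗ l ∶ B → x ⦂ A ∈ Γ → Γ ⊢ fvar x l ∶ B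
    t-conv : ∀ {Γ M A B s} → Γ ⊢ M ∶ A → Γ ⊢ B ∶ srt s → A ↔* B → Γ ⊢ M ∶ B
    t-app  : ∀ {Γ M A B l} → Γ ⊢ M ∶ A → Γ ∣ A ⊢ₗ l ∶ B → Γ ⊢ app M l ∶ B
    t-esub : ∀ {Γ Δ Δ' P A x M C} →
             Γ ⊢ P ∶ A → ((Γ ▸ x ⦂ A) ⧺ Δ) ⊢ M ∶ C →
             (Γ ⧺ substCtx P A x Δ) ⊑ Δ' → Wf Δ' →
             Δ' ⊢ esubN P A x M ∶ substTy P A x C

  data _∣_⊢ₗ_∶_ where
    l-nil   : ∀ {Γ A s} → Γ ⊢ A ∶ srt s → Γ ∣ A ⊢ₗ nil ∶ A
    l-cons  : ∀ {Γ A B M l C s} →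
              Γ ⊢ pi A B ∶ srt s → Γ ⊢ M ∶ A → Γ ∣ esub M A B ⊢ₗ l ∶ C →
              Γ ∣ pi A B ⊢ₗ cons M l ∶ C
    l-convR : ∀ {Γ C l A B s} → Γ ∣ C ⊢ₗ l ∶ A → Γ ⊢ B ∶ srt s → A ↔* B →
              Γ ∣ C ⊢ₗ l ∶ B
    l-convL : ∀ {Γ A l C B s} → Γ ∣ A ⊢ₗ l ∶ C → Γ ⊢ B ∶ srt s → A ↔* B →
              Γ ∣ B ⊢ₗ l ∶ C
    l-cat   : ∀ {Γ C l' A l B} → Γ ∣ C ⊢ₗ l' ∶ A → Γ ∣ A ⊢ₗ l ∶ B →
              Γ ∣ C ⊢ₗ cat l' l ∶ B
    l-sub   : ∀ {Γ Δ Δ' P A x B l C} →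
              Γ ⊢ P ∶ A → ((Γ ▸ x ⦂ A) ⧺ Δ) ∣ B ⊢ₗ l ∶ C →
              (Γ ⧺ substCtx P A x Δ) ⊑ Δ' → Wf Δ' →
              Δ' ∣ esubN P A x B ⊢ₗ lsubN P A x l ∶ esubN P A x C

  SN : Tm → Set
  SN = Acc (λ N M → M ⟶t N)

  StronglyNormalising : Set
  StronglyNormalising = ∀ Γ M A → Γ ⊢ M ∶ A → SN M

module PTS (S : Set) (Ax : S → S → Set) (Rl : S → S → S → Set) where

  data Tm : Set where
    var  : Name → Tm
    bvar : ℕ → Tm
    srt  : S → Tm
    pi   : Tm → Tm → Tm          -- Π x^U. T   (T binds index 0)
    lam  : Tm → Tm → Tm          -- λ x^U. t   (t binds index 0)
    app  : Tm → Tm → Tm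

  shift : ℕ → Tm → Tm
  shift c (var x)   = var x
  shift c (bvar i)  = bvar (if i <ᵇ c then i else suc i)
  shift c (srt s)   = srt s
  shift c (pi U T)  = pi (shift c U) (shift (suc c) T)
  shift c (lam U t) = lam (shift c U) (shift (suc c) t)
  shift c (app t u) = app (shift c t) (shift c u)

  substIx : ℕ → ℕ → Tm → Tm
  substIx k i u with <-cmp i k
  ... | tri< _ _ _ = bvar i
  ... | tri≈ _ _ _ = u
  ... | tri> _ _ _ = bvar (pred i)

  subst : ℕ → Tm → Tm → Tm
  subst k u (var x)   = var x
  subst k u (bvar i)  = substIx k i u
  subst k u (srt s)   = srt s
  subst k u (pi U T)  = pi (subst k u U) (subst (suc k) (shift 0 u) T)
  subst k u (lam U t) = lam (subst k u U) (subst (suc k) (shift 0 u) t)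
  subst k u (app t v) = app (subst k u t) (subst k u v)

  _[_] : Tm → Tm → Tm
  t [ u ] = subst 0 u t

  fv : Tm → List Name
  fv (var x)   = x ∷ []
  fv (bvar i)  = []
  fv (srt s)   = []
  fv (pi U T)  = fv U ++ fv T
  fv (lam U t) = fv U ++ fv t
  fv (app t u) = fv t ++ fv u

  infix 4 _⟶β_
  data _⟶β_ : Tm → Tm → Set where
    beta   : ∀ {V t u} → app (lam V t) u ⟶β t [ u ]
    c-pi₁  : ∀ {U U' T} → U ⟶β U' → pi U T ⟶β pi U' T
    c-pi₂  : ∀ {U T T'} → T ⟶β T' → pi U T ⟶β pi U T'
    c-lam₁ : ∀ {U U' t} → U ⟶β U' → lam U t ⟶β lam U' t
    c-lam₂ : ∀ {U t t'} → t ⟶β t' → lam U t ⟶β lam U t'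
    c-app₁ : ∀ {t t' u} → t ⟶β t' → app t u ⟶β app t' u
    c-app₂ : ∀ {t u u'} → u ⟶β u' → app t u ⟶β app t u'

  infix 4 _↔β*_
  _↔β*_ : Tm → Tm → Set
  _↔β*_ = EqClosure _⟶β_

  infixl 5 _▸_⦂_
  data Ctx : Set where
    ε     : Ctx
    _▸_⦂_ : Ctx → Name → Tm → Ctx

  dom : Ctx → List Name
  dom ε           = []
  dom (Γ ▸ x ⦂ A) = x ∷ dom Γ

  infix 4 _⦂_∈_
  data _⦂_∈_ : Name → Tm → Ctx → Set where
    here  : ∀ {Γ x A} → x ⦂ A ∈ (Γ ▸ x ⦂ A)
    there : ∀ {Γ x A y B} → x ⦂ A ∈ Γ → x ⦂ A ∈ (Γ ▸ y ⦂ B)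

  infix 3 _⊢_∶_
  data Wf : Ctx → Set
  data _⊢_∶_ : Ctx → Tm → Tm → Set

  data Wf where
    wf-ε   : Wf ε
    wf-ext : ∀ {Γ x T s} → Γ ⊢ T ∶ srt s → x ∉ dom Γ → Wf (Γ ▸ x ⦂ T)

  data _⊢_∶_ where
    t-var  : ∀ {Γ x T} → Wf Γ → x ⦂ T ∈ Γ → Γ ⊢ var x ∶ T
    t-sort : ∀ {Γ s s'} → Wf Γ → Ax s s' → Γ ⊢ srt s ∶ srt s'
    t-pi   : ∀ {Γ U T x s₁ s₂ s₃} →
             Γ ⊢ U ∶ srt s₁ → x ∉ fv T → (Γ ▸ x ⦂ U) ⊢ T [ var x ] ∶ srt s₂ →
             Rl s₁ s₂ s₃ → Γ ⊢ pi U T ∶ srt s₃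
    t-lam  : ∀ {Γ U T t x s} →
             Γ ⊢ pi U T ∶ srt s → x ∉ fv t → x ∉ fv T →
             (Γ ▸ x ⦂ U) ⊢ t [ var x ] ∶ T [ var x ] → Γ ⊢ lam U t ∶ pi U T
    t-app  : ∀ {Γ t u U T} → Γ ⊢ t ∶ pi U T → Γ ⊢ u ∶ U → Γ ⊢ app t u ∶ T [ u ]
    t-conv : ∀ {Γ t U V s} → Γ ⊢ t ∶ U → Γ ⊢ V ∶ srt s → U ↔β* V → Γ ⊢ t ∶ V

  SN : Tm → Set
  SN = Acc (λ u t → t ⟶β u)

  StronglyNormalising : Set
  StronglyNormalising = ∀ Γ t T → Γ ⊢ t ∶ T → SN t

PTSC-SN : (S : Set) → (S → S → Set) → (S → S → S → Set) → Set
PTSC-SN S Ax Rl = PTSC.StronglyNormalising S Ax Rl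

PTS-SN : (S : Set) → (S → S → Set) → (S → S → S → Set) → Set
PTS-SN S Ax Rl = PTS.StronglyNormalising S Ax Rl

{-# OPTIONS --safe #-}
module Submission where

{- Both directions pass through a de Bruijn presentation of the PTS whose rules carry redundant
   premises, so that renaming, substitution and type correctness are immediate inductions and
   its derivations are easily turned back into named ones of either calculus.

   From PTSC to PTS: with application encoded as t (u · []), the calculus of explicit substitutions
   simulates each β-step by at least one step, and the encoding preserves typing.

   From PTS to PTSC: executing the explicit substitutions maps a PTSC term M to a PTS term ℬ M, and a
   list to a sequence of arguments. This preserves typing, so ℬ M is strongly normalising for every
   typable M, but it may erase reductions. These are recovered compositionally: M l and ⟨P/x⟩_G M are
   strongly normalising as soon as their components and their images under ℬ are. This is an induction
   on the image, ordered by β-reduction and the subterm relation; when the image does not decrease,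
   a substitution has turned into applications, or the expression that a substitution or a list
   acts on has become smaller. No rule moves a substitution into another one, so what ℬ erases is
   never affected by a substitution coming from outside. -}

open import Defs
open import Data.Bool using (true; false; if_then_else_)
open import Data.Empty using (⊥-elim)
open import Data.List using (List; []; _∷_; _++_; map)
open import Data.List.Membership.Propositional using (_∈_; _∉_)
open import Data.List.Membership.Propositional.Properties using (∈-++⁺ˡ; ∈-++⁺ʳ)
open import Data.List.Properties using (map-∘; map-cong; map-++; ++-assoc; ++-identityʳ)
open import Data.List.Relation.Binary.Pointwise as Pw using (Pointwise; []; _∷_)
open import Data.List.Relation.Unary.All using (All; []; _∷_)
open import Data.List.Relation.Unary.All.Properties using (++⁻ˡ; ++⁻ʳ)
open import Data.List.Relation.Unary.Any using (here; there)
open import Data.Nat using (ℕ; zero; suc; _<ᵇ_; _≡ᵇ_; _≤_; s≤s)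
open import Data.Nat.ListAction using (sum)
open import Data.Nat.Properties using (<-cmp; ≡⇒≡ᵇ; ≡ᵇ⇒≡; m≤m+n; m≤n+m; ≤-trans; n≮n)
open import Data.Product using (∃-syntax; _×_; _,_; proj₁; proj₂)
open import Data.Sum using (_⊎_; inj₁; inj₂)
open import Data.Unit using (tt)
open import Function using (_∘_; flip)
open import Function.Bundles using (_⇔_; mk⇔)
open import Induction.WellFounded using (Acc; acc; WellFounded)
open import Relation.Binary.Construct.Closure.ReflexiveTransitive using (Star; _◅_; _◅◅_; gmap) renaming (ε to refl*)
open import Relation.Binary.Construct.Closure.Symmetric using (fwd; bwd)
open import Relation.Binary.Definitions using (tri<; tri≈; tri>)
open import Relation.Binary.PropositionalEquality hiding ([_])
import Relation.Binary.Construct.Closure.Equivalence as Eq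

-- Heads of variables and their renamings.

data Hd : Set where
  nm : Name → Hd
  bd : ℕ → Hd

↑h : Hd → Hd
↑h (nm x) = nm x
↑h (bd i) = bd (suc i)

-- A renaming may turn a name into an index or back, as closing and opening do, so under a binder
-- the image of a name has to be raised too, not only that of an index.
liftr : (Hd → Hd) → Hd → Hd
liftr f (nm x)       = ↑h (f (nm x))
liftr f (bd zero)    = bd zero
liftr f (bd (suc i)) = ↑h (f (bd i))

liftr-↑ : ∀ f h → liftr f (↑h h) ≡ ↑h (f h)
liftr-↑ f (nm x) = refl
liftr-↑ f (bd i) = refl

iterLift : ℕ → (Hd → Hd) → Hd → Hd
iterLift zero    f = f
iterLift (suc k) f = liftr (iterLift k f)

-- Parallel renaming and substitution on PTS terms.

module Substitutions (S : Set) (Ax : S → S → Set) (Rl : S → S → S → Set) where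
  module C = PTSC S Ax Rl
  module P = PTS S Ax Rl
  open P using (var; bvar; srt; pi; lam; app; _⟶β_; _[_])

  atom : Hd → P.Tm
  atom (nm x) = var x
  atom (bd i) = bvar i

  ren : (Hd → Hd) → P.Tm → P.Tm
  ren f (var x)   = atom (f (nm x))
  ren f (bvar i)  = atom (f (bd i))
  ren f (srt s)   = srt s
  ren f (pi U T)  = pi (ren f U) (ren (liftr f) T)
  ren f (lam U t) = lam (ren f U) (ren (liftr f) t)
  ren f (app t u) = app (ren f t) (ren f u)

  Sub : Set
  Sub = Hd → P.Tm

  lifts : Sub → Sub
  lifts σ (nm x)       = ren ↑h (σ (nm x))
  lifts σ (bd zero)    = bvar zero
  lifts σ (bd (suc i)) = ren ↑h (σ (bd i))

  sub : Sub → P.Tm → P.Tm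
  sub σ (var x)   = σ (nm x)
  sub σ (bvar i)  = σ (bd i)
  sub σ (srt s)   = srt s
  sub σ (pi U T)  = pi (sub σ U) (sub (lifts σ) T)
  sub σ (lam U t) = lam (sub σ U) (sub (lifts σ) t)
  sub σ (app t u) = app (sub σ t) (sub σ u)

  lifts-cong : ∀ {σ τ} → (∀ h → σ h ≡ τ h) → ∀ h → lifts σ h ≡ lifts τ h
  lifts-cong e (nm x)       = cong (ren ↑h) (e (nm x))
  lifts-cong e (bd zero)    = refl
  lifts-cong e (bd (suc i)) = cong (ren ↑h) (e (bd i))

  -- Substitutions are functions and are compared pointwise; this congruence takes the place of
  -- function extensionality in the equations below.
  sub-cong : ∀ {σ τ} → (∀ h → σ h ≡ τ h) → ∀ t → sub σ t ≡ sub τ t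
  sub-cong e (var x)   = e (nm x)
  sub-cong e (bvar i)  = e (bd i)
  sub-cong e (srt s)   = refl
  sub-cong e (pi U T)  = cong₂ pi (sub-cong e U) (sub-cong (lifts-cong e) T)
  sub-cong e (lam U t) = cong₂ lam (sub-cong e U) (sub-cong (lifts-cong e) t)
  sub-cong e (app t u) = cong₂ app (sub-cong e t) (sub-cong e u)

  ren-atom : ∀ f h → ren f (atom h) ≡ atom (f h)
  ren-atom f (nm x) = refl
  ren-atom f (bd i) = refl

  sub-atom : ∀ σ h → sub σ (atom h) ≡ σ h
  sub-atom σ (nm x) = refl
  sub-atom σ (bd i) = refl

  lifts-atom∘ : ∀ f h → atom (liftr f h) ≡ lifts (atom ∘ f) h
  lifts-atom∘ f (nm x)       = sym (ren-atom ↑h (f (nm x)))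
  lifts-atom∘ f (bd zero)    = refl
  lifts-atom∘ f (bd (suc i)) = sym (ren-atom ↑h (f (bd i)))

  -- `ren` has to be defined first because `lifts` uses it. Once it is seen as a substitution by
  -- atoms, its congruence and fusion laws are read off from those of `sub`.
  ren-as-sub : ∀ f t → ren f t ≡ sub (atom ∘ f) t
  ren-as-sub f (var x)   = refl
  ren-as-sub f (bvar i)  = refl
  ren-as-sub f (srt s)   = refl
  ren-as-sub f (pi U T)  = cong₂ pi (ren-as-sub f U) (trans (ren-as-sub (liftr f) T) (sub-cong (lifts-atom∘ f) T))
  ren-as-sub f (lam U t) = cong₂ lam (ren-as-sub f U) (trans (ren-as-sub (liftr f) t) (sub-cong (lifts-atom∘ f) t))
  ren-as-sub f (app t u) = cong₂ app (ren-as-sub f t) (ren-as-sub f u)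

  ren-cong : ∀ {f g} → (∀ h → f h ≡ g h) → ∀ t → ren f t ≡ ren g t
  ren-cong {f} {g} e t = trans (ren-as-sub f t) (trans (sub-cong (cong atom ∘ e) t) (sym (ren-as-sub g t)))

  lifts-↑ : ∀ σ h → lifts σ (↑h h) ≡ ren ↑h (σ h)
  lifts-↑ σ (nm x) = refl
  lifts-↑ σ (bd i) = refl

  lifts-∘r : ∀ σ f h → lifts σ (liftr f h) ≡ lifts (σ ∘ f) h
  lifts-∘r σ f (nm x)       = lifts-↑ σ (f (nm x))
  lifts-∘r σ f (bd zero)    = refl
  lifts-∘r σ f (bd (suc i)) = lifts-↑ σ (f (bd i))

  sub-ren : ∀ σ f t → sub σ (ren f t) ≡ sub (σ ∘ f) t
  sub-ren σ f (var x)   = sub-atom σ (f (nm x))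
  sub-ren σ f (bvar i)  = sub-atom σ (f (bd i))
  sub-ren σ f (srt s)   = refl
  sub-ren σ f (pi U T)  = cong₂ pi (sub-ren σ f U) (trans (sub-ren (lifts σ) (liftr f) T) (sub-cong (lifts-∘r σ f) T))
  sub-ren σ f (lam U t) = cong₂ lam (sub-ren σ f U) (trans (sub-ren (lifts σ) (liftr f) t) (sub-cong (lifts-∘r σ f) t))
  sub-ren σ f (app t u) = cong₂ app (sub-ren σ f t) (sub-ren σ f u)

  ren-ren : ∀ f g t → ren f (ren g t) ≡ ren (f ∘ g) t
  ren-ren f g t = trans (ren-as-sub f (ren g t)) (trans (sub-ren (atom ∘ f) g t) (sym (ren-as-sub (f ∘ g) t)))

  ren-↑-comm : ∀ f t → ren (liftr f) (ren ↑h t) ≡ ren ↑h (ren f t)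
  ren-↑-comm f t = trans (ren-ren (liftr f) ↑h t) (trans (ren-cong (liftr-↑ f) t) (sym (ren-ren ↑h f t)))

  ren-lifts : ∀ f σ h → ren (liftr f) (lifts σ h) ≡ lifts (ren f ∘ σ) h
  ren-lifts f σ (nm x)       = ren-↑-comm f (σ (nm x))
  ren-lifts f σ (bd zero)    = refl
  ren-lifts f σ (bd (suc i)) = ren-↑-comm f (σ (bd i))

  ren-sub : ∀ f σ t → ren f (sub σ t) ≡ sub (ren f ∘ σ) t
  ren-sub f σ (var x)   = refl
  ren-sub f σ (bvar i)  = refl
  ren-sub f σ (srt s)   = refl
  ren-sub f σ (pi U T)  = cong₂ pi (ren-sub f σ U) (trans (ren-sub (liftr f) (lifts σ) T) (sub-cong (ren-lifts f σ) T))
  ren-sub f σ (lam U t) = cong₂ lam (ren-sub f σ U) (trans (ren-sub (liftr f) (lifts σ) t) (sub-cong (ren-lifts f σ) t))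
  ren-sub f σ (app t u) = cong₂ app (ren-sub f σ t) (ren-sub f σ u)

  sub-lifts-↑ : ∀ σ t → sub (lifts σ) (ren ↑h t) ≡ ren ↑h (sub σ t)
  sub-lifts-↑ σ t = trans (sub-ren (lifts σ) ↑h t) (trans (sub-cong (lifts-↑ σ) t) (sym (ren-sub ↑h σ t)))

  sub-lifts : ∀ σ τ h → sub (lifts σ) (lifts τ h) ≡ lifts (sub σ ∘ τ) h
  sub-lifts σ τ (nm x)       = sub-lifts-↑ σ (τ (nm x))
  sub-lifts σ τ (bd zero)    = refl
  sub-lifts σ τ (bd (suc i)) = sub-lifts-↑ σ (τ (bd i))

  -- The last of the fusion laws, which have to come in this order: pushing `ren` past `lifts` rests
  -- on `sub-ren`, and pushing `sub` past `lifts` rests on `sub-ren` and `ren-sub`.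
  sub-sub : ∀ σ τ t → sub σ (sub τ t) ≡ sub (sub σ ∘ τ) t
  sub-sub σ τ (var x)   = refl
  sub-sub σ τ (bvar i)  = refl
  sub-sub σ τ (srt s)   = refl
  sub-sub σ τ (pi U T)  = cong₂ pi (sub-sub σ τ U) (trans (sub-sub (lifts σ) (lifts τ) T) (sub-cong (sub-lifts σ τ) T))
  sub-sub σ τ (lam U t) = cong₂ lam (sub-sub σ τ U) (trans (sub-sub (lifts σ) (lifts τ) t) (sub-cong (sub-lifts σ τ) t))
  sub-sub σ τ (app t u) = cong₂ app (sub-sub σ τ t) (sub-sub σ τ u)

  lifts-atom : ∀ h → lifts atom h ≡ atom h
  lifts-atom (nm x)       = refl
  lifts-atom (bd zero)    = refl
  lifts-atom (bd (suc i)) = refl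

  sub-id : ∀ t → sub atom t ≡ t
  sub-id (var x)   = refl
  sub-id (bvar i)  = refl
  sub-id (srt s)   = refl
  sub-id (pi U T)  = cong₂ pi (sub-id U) (trans (sub-cong lifts-atom T) (sub-id T))
  sub-id (lam U t) = cong₂ lam (sub-id U) (trans (sub-cong lifts-atom t) (sub-id t))
  sub-id (app t u) = cong₂ app (sub-id t) (sub-id u)

  shiftH-nm : ∀ c x → iterLift c ↑h (nm x) ≡ nm x
  shiftH-nm zero    x = refl
  shiftH-nm (suc c) x = cong ↑h (shiftH-nm c x)

  shiftH-bd : ∀ c i → iterLift c ↑h (bd i) ≡ bd (if i <ᵇ c then i else suc i)
  shiftH-bd zero    i       = refl
  shiftH-bd (suc c) zero    = refl
  shiftH-bd (suc c) (suc i) with i <ᵇ c | shiftH-bd c i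
  ... | true  | e = cong ↑h e
  ... | false | e = cong ↑h e

  shift-as-ren : ∀ c t → P.shift c t ≡ ren (iterLift c ↑h) t
  shift-as-ren c (var x)   = sym (cong atom (shiftH-nm c x))
  shift-as-ren c (bvar i)  = sym (cong atom (shiftH-bd c i))
  shift-as-ren c (srt s)   = refl
  shift-as-ren c (pi U T)  = cong₂ pi (shift-as-ren c U) (shift-as-ren (suc c) T)
  shift-as-ren c (lam U t) = cong₂ lam (shift-as-ren c U) (shift-as-ren (suc c) t)
  shift-as-ren c (app t u) = cong₂ app (shift-as-ren c t) (shift-as-ren c u)

  substH : ℕ → P.Tm → Sub
  substH k u (nm x) = var x
  substH k u (bd i) = P.substIx k i u

  lifts-substH : ∀ k u h → lifts (substH k u) h ≡ substH (suc k) (P.shift 0 u) h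
  lifts-substH k u (nm x)    = refl
  lifts-substH k u (bd zero) with <-cmp 0 (suc k)
  ... | tri< _ _ _ = refl
  ... | tri> _ _ ()
  lifts-substH k u (bd (suc i)) with <-cmp i k | <-cmp (suc i) (suc k)
  ... | tri< _ _ _ | tri< _ _ _ = refl
  ... | tri< p _ _ | tri≈ q _ _ = ⊥-elim (q (s≤s p))
  ... | tri< p _ _ | tri> q _ _ = ⊥-elim (q (s≤s p))
  ... | tri≈ _ refl _ | tri< _ q _ = ⊥-elim (q refl)
  ... | tri≈ _ _ _ | tri≈ _ _ _ = sym (shift-as-ren 0 u)
  ... | tri≈ _ refl _ | tri> _ q _ = ⊥-elim (q refl)
  ... | tri> _ _ p | tri< _ _ q = ⊥-elim (q (s≤s p))
  ... | tri> _ _ p | tri≈ _ _ q = ⊥-elim (q (s≤s p))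
  -- An index above `k` is a successor; exposing it lets `suc` after `pred` compute.
  lifts-substH k u (bd (suc (suc i))) | tri> _ _ _ | tri> _ _ _ = refl

  subst-as-sub : ∀ k u t → P.subst k u t ≡ sub (substH k u) t
  subst-as-sub k u (var x)   = refl
  subst-as-sub k u (bvar i)  = refl
  subst-as-sub k u (srt s)   = refl
  subst-as-sub k u (pi U T)  = cong₂ pi (subst-as-sub k u U)
    (trans (subst-as-sub (suc k) (P.shift 0 u) T) (sym (sub-cong (lifts-substH k u) T)))
  subst-as-sub k u (lam U t) = cong₂ lam (subst-as-sub k u U)
    (trans (subst-as-sub (suc k) (P.shift 0 u) t) (sym (sub-cong (lifts-substH k u) t)))
  subst-as-sub k u (app t v) = cong₂ app (subst-as-sub k u t) (subst-as-sub k u v)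

  infixr 5 _•_
  -- The cons of explicit substitution calculi; `u • atom` is the parallel form of `_[ u ]`.
  _•_ : P.Tm → Sub → Sub
  (u • σ) (nm x)       = σ (nm x)
  (u • σ) (bd zero)    = u
  (u • σ) (bd (suc i)) = σ (bd i)

  •-cong : ∀ {u v σ τ} → u ≡ v → (∀ h → σ h ≡ τ h) → ∀ h → (u • σ) h ≡ (v • τ) h
  •-cong e p (nm x)       = p (nm x)
  •-cong e p (bd zero)    = e
  •-cong e p (bd (suc i)) = p (bd i)

  []-as-sub : ∀ t u → t [ u ] ≡ sub (u • atom) t
  []-as-sub t u = trans (subst-as-sub 0 u t) (sub-cong pt t)
    where
    pt : ∀ h → substH 0 u h ≡ (u • atom) h
    pt (nm x)       = refl
    pt (bd zero)    = refl
    pt (bd (suc i)) = refl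

  sub-• : ∀ σ u τ h → sub σ ((u • τ) h) ≡ (sub σ u • (sub σ ∘ τ)) h
  sub-• σ u τ (nm x)       = refl
  sub-• σ u τ (bd zero)    = refl
  sub-• σ u τ (bd (suc i)) = refl

  •-↑ : ∀ u σ t → sub (u • σ) (ren ↑h t) ≡ sub σ t
  •-↑ u σ t = trans (sub-ren (u • σ) ↑h t) (sub-cong (λ { (nm x) → refl ; (bd i) → refl }) t)

  •-lifts : ∀ u σ τ h → sub (u • σ) (lifts τ h) ≡ (u • (sub σ ∘ τ)) h
  •-lifts u σ τ (nm x)       = •-↑ u σ (τ (nm x))
  •-lifts u σ τ (bd zero)    = refl
  •-lifts u σ τ (bd (suc i)) = •-↑ u σ (τ (bd i))

  sub-[] : ∀ σ t u → sub σ (t [ u ]) ≡ sub (sub σ u • σ) t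
  sub-[] σ t u = trans (cong (sub σ) ([]-as-sub t u)) (trans (sub-sub σ (u • atom) t)
    (sub-cong (λ h → trans (sub-• σ u atom h) (•-cong refl (sub-atom σ) h)) t))

  lifts-[] : ∀ σ t u → sub (lifts σ) t [ u ] ≡ sub (u • σ) t
  lifts-[] σ t u = trans ([]-as-sub (sub (lifts σ) t) u) (trans (sub-sub (u • atom) (lifts σ) t)
    (sub-cong (λ h → trans (•-lifts u atom σ h) (•-cong refl (sub-id ∘ σ) h)) t))

  -- The substitution lemma: both sides collapse to the single parallel substitution `sub σ u • σ`.
  sub-[]-comm : ∀ σ t u → sub σ (t [ u ]) ≡ sub (lifts σ) t [ sub σ u ]
  sub-[]-comm σ t u = trans (sub-[] σ t u) (sym (lifts-[] σ t (sub σ u)))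

  ren-[]-comm : ∀ f t u → ren f (t [ u ]) ≡ ren (liftr f) t [ ren f u ]
  ren-[]-comm f t u = trans (ren-as-sub f (t [ u ])) (trans (sub-[] (atom ∘ f) t u)
    (trans (sub-cong (•-cong (sym (ren-as-sub f u)) (λ _ → refl)) t)
    (trans (sym (lifts-[] (atom ∘ f) t (ren f u)))
      (cong (_[ ren f u ]) (sym (ren-as-sub-lift f t))))))
    where
    ren-as-sub-lift : ∀ f t → ren (liftr f) t ≡ sub (lifts (atom ∘ f)) t
    ren-as-sub-lift f t = trans (ren-as-sub (liftr f) t) (sub-cong (lifts-atom∘ f) t)

  sub-β : ∀ σ {t t'} → t ⟶β t' → sub σ t ⟶β sub σ t'
  sub-β σ (P.beta {V} {t} {u}) =
    subst (sub σ (app (lam V t) u) ⟶β_) (sym (sub-[]-comm σ t u)) P.beta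
  sub-β σ (P.c-pi₁ r)  = P.c-pi₁ (sub-β σ r)
  sub-β σ (P.c-pi₂ r)  = P.c-pi₂ (sub-β (lifts σ) r)
  sub-β σ (P.c-lam₁ r) = P.c-lam₁ (sub-β σ r)
  sub-β σ (P.c-lam₂ r) = P.c-lam₂ (sub-β (lifts σ) r)
  sub-β σ (P.c-app₁ r) = P.c-app₁ (sub-β σ r)
  sub-β σ (P.c-app₂ r) = P.c-app₂ (sub-β σ r)

  ren-β : ∀ f {t t'} → t ⟶β t' → ren f t ⟶β ren f t'
  ren-β f {t} {t'} r = subst₂ _⟶β_ (sym (ren-as-sub f t)) (sym (ren-as-sub f t')) (sub-β (atom ∘ f) r)

  infix 4 _⟶β*_
  _⟶β*_ : P.Tm → P.Tm → Set
  _⟶β*_ = Star _⟶β_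

  _⟶*s_ : Sub → Sub → Set
  σ ⟶*s τ = ∀ h → σ h ⟶β* τ h

  lifts-* : ∀ {σ τ} → σ ⟶*s τ → lifts σ ⟶*s lifts τ
  lifts-* r (nm x)       = gmap (ren ↑h) (ren-β ↑h) (r (nm x))
  lifts-* r (bd zero)    = refl*
  lifts-* r (bd (suc i)) = gmap (ren ↑h) (ren-β ↑h) (r (bd i))

  pi* : ∀ {U U' T T'} → U ⟶β* U' → T ⟶β* T' → pi U T ⟶β* pi U' T'
  pi* r q = gmap (λ U → pi U _) P.c-pi₁ r ◅◅ gmap (pi _) P.c-pi₂ q

  lam* : ∀ {U U' T T'} → U ⟶β* U' → T ⟶β* T' → lam U T ⟶β* lam U' T'
  lam* r q = gmap (λ U → lam U _) P.c-lam₁ r ◅◅ gmap (lam _) P.c-lam₂ q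

  app* : ∀ {U U' T T'} → U ⟶β* U' → T ⟶β* T' → app U T ⟶β* app U' T'
  app* r q = gmap (λ U → app U _) P.c-app₁ r ◅◅ gmap (app _) P.c-app₂ q

  -- Many steps, or none, may answer a single step in `σ`, since the image of a variable is copied
  -- once for each occurrence.
  sub-* : ∀ {σ τ} → σ ⟶*s τ → ∀ t → sub σ t ⟶β* sub τ t
  sub-* r (var x)   = r (nm x)
  sub-* r (bvar i)  = r (bd i)
  sub-* r (srt s)   = refl*
  sub-* r (pi U T)  = pi* (sub-* r U) (sub-* (lifts-* r) T)
  sub-* r (lam U t) = lam* (sub-* r U) (sub-* (lifts-* r) t)
  sub-* r (app t u) = app* (sub-* r t) (sub-* r u)

  []-*₂ : ∀ t {u u'} → u ⟶β* u' → t [ u ] ⟶β* t [ u' ]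
  []-*₂ t {u} {u'} r = subst₂ _⟶β*_ (sym ([]-as-sub t u)) (sym ([]-as-sub t u'))
    (sub-* (λ { (nm x) → refl* ; (bd zero) → r ; (bd (suc i)) → refl* }) t)

  []-*₁ : ∀ {t t'} u → t ⟶β* t' → t [ u ] ⟶β* t' [ u ]
  []-*₁ {t} {t'} u r = gmap (_[ u ]) (λ {a} {b} q →
    subst₂ _⟶β_ (sym ([]-as-sub a u)) (sym ([]-as-sub b u)) (sub-β (u • atom) q)) r

-- Swapping, opening and closing on heads, and relations under binders.

swapH : Hd → Hd
swapH (bd 0) = bd 1
swapH (bd 1) = bd 0
swapH h      = h

openH : Name → Hd → Hd
openH x (bd 0) = nm x
openH x h      = h

-- Mirrors `closeT`, which leaves dangling indices in place: the closed name and index 0 are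
-- identified, so this renaming is not injective.
closeH : Name → Hd → Hd
closeH x (nm y) = if y ≡ᵇ x then bd 0 else nm y
closeH x (bd i) = bd i

-- The freshly bound index is related to itself alone. Spelling out the shapes of both heads lets a
-- match on the relation decide which rule for substituting into a variable applies.
data LiftR (R : Hd → Hd → Set) : Hd → Hd → Set where
  zz : LiftR R (bd 0) (bd 0)
  nn : ∀ {x y} → R (nm x) (nm y) → LiftR R (nm x) (nm y)
  nb : ∀ {x j} → R (nm x) (bd j) → LiftR R (nm x) (bd (suc j))
  bn : ∀ {i y} → R (bd i) (nm y) → LiftR R (bd (suc i)) (nm y)
  bb : ∀ {i j} → R (bd i) (bd j) → LiftR R (bd (suc i)) (bd (suc j))

LiftR-↑ : ∀ {R} h h' → R h h' → LiftR R (↑h h) (↑h h')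
LiftR-↑ (nm x) (nm y) = nn
LiftR-↑ (nm x) (bd j) = nb
LiftR-↑ (bd i) (nm y) = bn
LiftR-↑ (bd i) (bd j) = bb

LiftR-map : ∀ {R R' g g'} → (∀ {h h'} → R h h' → R' (g h) (g' h')) →
            ∀ {h h'} → LiftR R h h' → LiftR R' (liftr g h) (liftr g' h')
LiftR-map p zz     = zz
LiftR-map p (nn r) = LiftR-↑ _ _ (p r)
LiftR-map p (nb r) = LiftR-↑ _ _ (p r)
LiftR-map p (bn r) = LiftR-↑ _ _ (p r)
LiftR-map p (bb r) = LiftR-↑ _ _ (p r)

LiftR-graph : ∀ {R f} → (∀ h → R h (f h)) → ∀ h → LiftR R h (liftr f h)
LiftR-graph p (nm x)       = LiftR-↑ (nm x) _ (p (nm x))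
LiftR-graph p (bd zero)    = zz
LiftR-graph p (bd (suc i)) = LiftR-↑ (bd i) _ (p (bd i))

LiftR-cograph : ∀ {R f} → (∀ h → R (f h) h) → ∀ h → LiftR R (liftr f h) h
LiftR-cograph p (nm x)       = LiftR-↑ _ (nm x) (p (nm x))
LiftR-cograph p (bd zero)    = zz
LiftR-cograph p (bd (suc i)) = LiftR-↑ _ (bd i) (p (bd i))

LiftR-swap : ∀ {R h h'} → LiftR (LiftR R) h h' → LiftR (LiftR R) (swapH h) (swapH h')
LiftR-swap zz          = bb zz
LiftR-swap (nn r)      = nn r
LiftR-swap (nb (nb r)) = nb (nb r)
LiftR-swap (bn (bn r)) = bn (bn r)
LiftR-swap (bb zz)     = zz
LiftR-swap (bb (bb r)) = bb (bb r)

-- Head renaming on PTSC expressions and its effect on normalisation.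

module HeadRenaming (S : Set) (Ax : S → S → Set) (Rl : S → S → S → Set) where
  open Substitutions S Ax Rl
  open C using (pi; lam; srt; fvar; bvar; app; esub; nil; cons; cat; lsub; _⟶t_; _⟶l_)

  mk : Hd → C.Ls → C.Tm
  mk (nm x) l = fvar x l
  mk (bd i) l = bvar i l

  hrenT : (Hd → Hd) → C.Tm → C.Tm
  hrenL : (Hd → Hd) → C.Ls → C.Ls
  hrenT f (pi A B)     = pi (hrenT f A) (hrenT (liftr f) B)
  hrenT f (lam A M)    = lam (hrenT f A) (hrenT (liftr f) M)
  hrenT f (srt s)      = srt s
  hrenT f (fvar x l)   = mk (f (nm x)) (hrenL f l)
  hrenT f (bvar i l)   = mk (f (bd i)) (hrenL f l)
  hrenT f (app M l)    = app (hrenT f M) (hrenL f l)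
  hrenT f (esub P A M) = esub (hrenT f P) (hrenT f A) (hrenT (liftr f) M)
  hrenL f nil          = nil
  hrenL f (cons M l)   = cons (hrenT f M) (hrenL f l)
  hrenL f (cat l l')   = cat (hrenL f l) (hrenL f l')
  hrenL f (lsub P A l) = lsub (hrenT f P) (hrenT f A) (hrenL (liftr f) l)

  -- Reduces an equation between a traversal and a renaming to two computations on heads, one for
  -- indices and one for names, at every depth.
  module TravRen {bv : ℕ → ℕ → C.Ls → C.Tm} {fv : ℕ → Name → C.Ls → C.Tm} (f : Hd → Hd)
                 (pb : ∀ k i l → bv k i l ≡ mk (iterLift k f (bd i)) l)
                 (pf : ∀ k x l → fv k x l ≡ mk (iterLift k f (nm x)) l) where
    open C.Trav bv fv
    travT-hren : ∀ k M → travT k M ≡ hrenT (iterLift k f) M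
    travL-hren : ∀ k l → travL k l ≡ hrenL (iterLift k f) l
    travT-hren k (pi A B)     = cong₂ pi (travT-hren k A) (travT-hren (suc k) B)
    travT-hren k (lam A M)    = cong₂ lam (travT-hren k A) (travT-hren (suc k) M)
    travT-hren k (srt s)      = refl
    travT-hren k (fvar x l)   = trans (pf k x _) (cong (mk _) (travL-hren k l))
    travT-hren k (bvar i l)   = trans (pb k i _) (cong (mk _) (travL-hren k l))
    travT-hren k (app M l)    = cong₂ app (travT-hren k M) (travL-hren k l)
    travT-hren k (esub P A M) rewrite travT-hren k P | travT-hren k A | travT-hren (suc k) M = refl
    travL-hren k nil          = refl
    travL-hren k (cons M l)   = cong₂ cons (travT-hren k M) (travL-hren k l)
    travL-hren k (cat l l')   = cong₂ cat (travL-hren k l) (travL-hren k l')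
    travL-hren k (lsub P A l) rewrite travT-hren k P | travT-hren k A | travL-hren (suc k) l = refl

  iterLift-nm : ∀ {f x} → f (nm x) ≡ nm x → ∀ k → iterLift k f (nm x) ≡ nm x
  iterLift-nm e zero    = e
  iterLift-nm e (suc k) = cong ↑h (iterLift-nm e k)

  swapH-bd : ∀ k i → iterLift k swapH (bd i) ≡ bd (C.swapIx k i)
  swapH-bd zero    zero          = refl
  swapH-bd zero    (suc zero)    = refl
  swapH-bd zero    (suc (suc i)) = refl
  swapH-bd (suc k) zero          = refl
  swapH-bd (suc k) (suc i) with i ≡ᵇ k | i ≡ᵇ suc k | swapH-bd k i
  ... | true  | _     | e = cong ↑h e
  ... | false | true  | e = cong ↑h e
  ... | false | false | e = cong ↑h e

  openH-bd : ∀ x k i → iterLift k (openH x) (bd i) ≡ (if i ≡ᵇ k then nm x else bd i)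
  openH-bd x zero    zero    = refl
  openH-bd x zero    (suc i) = refl
  openH-bd x (suc k) zero    = refl
  openH-bd x (suc k) (suc i) with i ≡ᵇ k | openH-bd x k i
  ... | true  | e = cong ↑h e
  ... | false | e = cong ↑h e

  closeH-bd : ∀ x k i → iterLift k (closeH x) (bd i) ≡ bd i
  closeH-bd x zero    i       = refl
  closeH-bd x (suc k) zero    = refl
  closeH-bd x (suc k) (suc i) = cong ↑h (closeH-bd x k i)

  closeH-nm : ∀ x k y → iterLift k (closeH x) (nm y) ≡ (if y ≡ᵇ x then bd k else nm y)
  closeH-nm x zero    y = refl
  closeH-nm x (suc k) y with y ≡ᵇ x | closeH-nm x k y
  ... | true  | e = cong ↑h e
  ... | false | e = cong ↑h e

  mk-if : ∀ b h h' l → (if b then mk h l else mk h' l) ≡ mk (if b then h else h') l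
  mk-if true  h h' l = refl
  mk-if false h h' l = refl

  shiftT-hren : ∀ M → C.shiftT 0 M ≡ hrenT ↑h M
  shiftT-hren = TravRen.travT-hren ↑h (λ k i l → cong (λ h → mk h l) (sym (shiftH-bd k i)))
    (λ k x l → cong (λ h → mk h l) (sym (shiftH-nm k x))) 0

  swapT-hren : ∀ M → C.swapT 0 M ≡ hrenT swapH M
  swapT-hren = TravRen.travT-hren swapH (λ k i l → cong (λ h → mk h l) (sym (swapH-bd k i)))
    (λ k x l → cong (λ h → mk h l) (sym (iterLift-nm refl k))) 0

  openT-hren : ∀ x M → C.openT x M ≡ hrenT (openH x) M
  openT-hren x = TravRen.travT-hren (openH x)
    (λ k i l → trans (mk-if (i ≡ᵇ k) (nm x) (bd i) l) (cong (λ h → mk h l) (sym (openH-bd x k i))))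
    (λ k y l → cong (λ h → mk h l) (sym (iterLift-nm refl k))) 0

  module CloseRen x = TravRen {λ _ i l → bvar i l} {C.closeF x} (closeH x)
    (λ k i l → cong (λ h → mk h l) (sym (closeH-bd x k i)))
    (λ k y l → trans (mk-if (y ≡ᵇ x) (bd k) (nm y) l) (cong (λ h → mk h l) (sym (closeH-nm x k y))))

  closeT-hren : ∀ x M → C.closeT x M ≡ hrenT (closeH x) M
  closeT-hren x = CloseRen.travT-hren x 0

  closeL-hren : ∀ x l → C.closeL x l ≡ hrenL (closeH x) l
  closeL-hren x = CloseRen.travL-hren x 0

  -- A relation rather than a function on heads, so that one simulation lemma yields both
  -- preservation and reflection of strong normalisation under renaming.
  data RelT (R : Hd → Hd → Set) : C.Tm → C.Tm → Set
  data RelL (R : Hd → Hd → Set) : C.Ls → C.Ls → Set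
  data RelT R where
    pi   : ∀ {A A' B B'} → RelT R A A' → RelT (LiftR R) B B' → RelT R (pi A B) (pi A' B')
    lam  : ∀ {A A' B B'} → RelT R A A' → RelT (LiftR R) B B' → RelT R (lam A B) (lam A' B')
    srt  : ∀ {s} → RelT R (srt s) (srt s)
    nn   : ∀ {x y l l'} → R (nm x) (nm y) → RelL R l l' → RelT R (fvar x l) (fvar y l')
    nb   : ∀ {x y l l'} → R (nm x) (bd y) → RelL R l l' → RelT R (fvar x l) (bvar y l')
    bn   : ∀ {x y l l'} → R (bd x) (nm y) → RelL R l l' → RelT R (bvar x l) (fvar y l')
    bb   : ∀ {x y l l'} → R (bd x) (bd y) → RelL R l l' → RelT R (bvar x l) (bvar y l')
    app  : ∀ {M M' l l'} → RelT R M M' → RelL R l l' → RelT R (app M l) (app M' l')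
    esub : ∀ {P P' A A' M M'} → RelT R P P' → RelT R A A' → RelT (LiftR R) M M' →
           RelT R (esub P A M) (esub P' A' M')
  data RelL R where
    nil  : RelL R nil nil
    cons : ∀ {M M' l l'} → RelT R M M' → RelL R l l' → RelL R (cons M l) (cons M' l')
    cat  : ∀ {M M' l l'} → RelL R M M' → RelL R l l' → RelL R (cat M l) (cat M' l')
    lsub : ∀ {P P' A A' M M'} → RelT R P P' → RelT R A A' → RelL (LiftR R) M M' →
           RelL R (lsub P A M) (lsub P' A' M')

  rel-mk : ∀ {R} h h' {l l'} → R h h' → RelL R l l' → RelT R (mk h l) (mk h' l')
  rel-mk (nm x) (nm y) = nn
  rel-mk (nm x) (bd j) = nb
  rel-mk (bd i) (nm y) = bn
  rel-mk (bd i) (bd j) = bb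

  rel-mapT : ∀ {R R' g g'} → (∀ {h h'} → R h h' → R' (g h) (g' h')) →
             ∀ {M M'} → RelT R M M' → RelT R' (hrenT g M) (hrenT g' M')
  rel-mapL : ∀ {R R' g g'} → (∀ {h h'} → R h h' → R' (g h) (g' h')) →
             ∀ {l l'} → RelL R l l' → RelL R' (hrenL g l) (hrenL g' l')
  rel-mapT p (pi r s)     = pi (rel-mapT p r) (rel-mapT (LiftR-map p) s)
  rel-mapT p (lam r s)    = lam (rel-mapT p r) (rel-mapT (LiftR-map p) s)
  rel-mapT p srt          = srt
  rel-mapT p (nn e r)     = rel-mk _ _ (p e) (rel-mapL p r)
  rel-mapT p (nb e r)     = rel-mk _ _ (p e) (rel-mapL p r)
  rel-mapT p (bn e r)     = rel-mk _ _ (p e) (rel-mapL p r)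
  rel-mapT p (bb e r)     = rel-mk _ _ (p e) (rel-mapL p r)
  rel-mapT p (app r s)    = app (rel-mapT p r) (rel-mapL p s)
  rel-mapT p (esub r s t) = esub (rel-mapT p r) (rel-mapT p s) (rel-mapT (LiftR-map p) t)
  rel-mapL p nil          = nil
  rel-mapL p (cons r s)   = cons (rel-mapT p r) (rel-mapL p s)
  rel-mapL p (cat r s)    = cat (rel-mapL p r) (rel-mapL p s)
  rel-mapL p (lsub r s t) = lsub (rel-mapT p r) (rel-mapT p s) (rel-mapL (LiftR-map p) t)

  rel-graphT : ∀ {R f} → (∀ h → R h (f h)) → ∀ M → RelT R M (hrenT f M)
  rel-graphL : ∀ {R f} → (∀ h → R h (f h)) → ∀ l → RelL R l (hrenL f l)
  rel-graphT p (pi A B)     = pi (rel-graphT p A) (rel-graphT (LiftR-graph p) B)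
  rel-graphT p (lam A M)    = lam (rel-graphT p A) (rel-graphT (LiftR-graph p) M)
  rel-graphT p (srt s)      = srt
  rel-graphT p (fvar x l)   = rel-mk (nm x) _ (p (nm x)) (rel-graphL p l)
  rel-graphT p (bvar i l)   = rel-mk (bd i) _ (p (bd i)) (rel-graphL p l)
  rel-graphT p (app M l)    = app (rel-graphT p M) (rel-graphL p l)
  rel-graphT p (esub P A M) = esub (rel-graphT p P) (rel-graphT p A) (rel-graphT (LiftR-graph p) M)
  rel-graphL p nil          = nil
  rel-graphL p (cons M l)   = cons (rel-graphT p M) (rel-graphL p l)
  rel-graphL p (cat l l')   = cat (rel-graphL p l) (rel-graphL p l')
  rel-graphL p (lsub P A l) = lsub (rel-graphT p P) (rel-graphT p A) (rel-graphL (LiftR-graph p) l)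

  rel-cographT : ∀ {R f} → (∀ h → R (f h) h) → ∀ M → RelT R (hrenT f M) M
  rel-cographL : ∀ {R f} → (∀ h → R (f h) h) → ∀ l → RelL R (hrenL f l) l
  rel-cographT p (pi A B)     = pi (rel-cographT p A) (rel-cographT (LiftR-cograph p) B)
  rel-cographT p (lam A M)    = lam (rel-cographT p A) (rel-cographT (LiftR-cograph p) M)
  rel-cographT p (srt s)      = srt
  rel-cographT p (fvar x l)   = rel-mk _ (nm x) (p (nm x)) (rel-cographL p l)
  rel-cographT p (bvar i l)   = rel-mk _ (bd i) (p (bd i)) (rel-cographL p l)
  rel-cographT p (app M l)    = app (rel-cographT p M) (rel-cographL p l)
  rel-cographT p (esub P A M) = esub (rel-cographT p P) (rel-cographT p A) (rel-cographT (LiftR-cograph p) M)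
  rel-cographL p nil          = nil
  rel-cographL p (cons M l)   = cons (rel-cographT p M) (rel-cographL p l)
  rel-cographL p (cat l l')   = cat (rel-cographL p l) (rel-cographL p l')
  rel-cographL p (lsub P A l) = lsub (rel-cographT p P) (rel-cographT p A) (rel-cographL (LiftR-cograph p) l)

  rel-shift : ∀ {R M M'} → RelT R M M' → RelT (LiftR R) (C.shiftT 0 M) (C.shiftT 0 M')
  rel-shift {R} {M} {M'} r rewrite shiftT-hren M | shiftT-hren M' = rel-mapT (LiftR-↑ _ _) r

  rel-swap : ∀ {R M M'} → RelT (LiftR (LiftR R)) M M' →
             RelT (LiftR (LiftR R)) (C.swapT 0 M) (C.swapT 0 M')
  rel-swap {R} {M} {M'} r rewrite swapT-hren M | swapT-hren M' = rel-mapT LiftR-swap r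

  -- No rule compares two free heads. The only test is whether a head is the index bound by the
  -- substitution, and `LiftR` relates that index only to itself. So `R` may be any relation,
  -- injective or not, and each step is matched by exactly one step.
  simT : ∀ {R M M' N} → RelT R M M' → M ⟶t N → ∃[ N' ] (M' ⟶t N' × RelT R N N')
  simL : ∀ {R l l' k} → RelL R l l' → l ⟶l k → ∃[ k' ] (l' ⟶l k' × RelL R k k')
  simT (app (lam a m) (cons n l)) C.r-beta = _ , C.r-beta , app (esub n a m) l
  simT (app m nil) C.r-nil = _ , C.r-nil , m
  simT (app (nn e l) l') C.r-fvar = _ , C.r-fvar , nn e (cat l l')
  simT (app (nb e l) l') C.r-fvar = _ , C.r-bvar , nb e (cat l l')
  simT (app (bn e l) l') C.r-bvar = _ , C.r-fvar , bn e (cat l l')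
  simT (app (bb e l) l') C.r-bvar = _ , C.r-bvar , bb e (cat l l')
  simT (app (app m l) l') C.r-app = _ , C.r-app , app m (cat l l')
  simT (esub p g (lam a m)) C.r-s-lam =
    _ , C.r-s-lam , lam (esub p g a) (esub (rel-shift p) (rel-shift g) (rel-swap m))
  simT (esub p g (bb zz l)) C.r-s-hit = _ , C.r-s-hit , app p (lsub p g l)
  simT (esub p g (bn (bn e) l)) C.r-s-bvar = _ , C.r-s-fvar , bn e (lsub p g l)
  simT (esub p g (bb (bb e) l)) C.r-s-bvar = _ , C.r-s-bvar , bb e (lsub p g l)
  simT (esub p g (nn (nn e) l)) C.r-s-fvar = _ , C.r-s-fvar , nn e (lsub p g l)
  simT (esub p g (nb (nb e) l)) C.r-s-fvar = _ , C.r-s-bvar , nb e (lsub p g l)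
  simT (esub p g (app m l)) C.r-s-app = _ , C.r-s-app , app (esub p g m) (lsub p g l)
  simT (esub p g (pi a m)) C.r-s-pi =
    _ , C.r-s-pi , pi (esub p g a) (esub (rel-shift p) (rel-shift g) (rel-swap m))
  simT (esub p g srt) C.r-s-srt = _ , C.r-s-srt , srt
  simT (pi a b) (C.c-pi₁ s) with _ , s' , a' ← simT a s = _ , C.c-pi₁ s' , pi a' b
  simT (pi a b) (C.c-pi₂ s) with _ , s' , b' ← simT b s = _ , C.c-pi₂ s' , pi a b'
  simT (lam a b) (C.c-lam₁ s) with _ , s' , a' ← simT a s = _ , C.c-lam₁ s' , lam a' b
  simT (lam a b) (C.c-lam₂ s) with _ , s' , b' ← simT b s = _ , C.c-lam₂ s' , lam a b'
  simT (nn e l) (C.c-fvar s) with _ , s' , l' ← simL l s = _ , C.c-fvar s' , nn e l'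
  simT (nb e l) (C.c-fvar s) with _ , s' , l' ← simL l s = _ , C.c-bvar s' , nb e l'
  simT (bn e l) (C.c-bvar s) with _ , s' , l' ← simL l s = _ , C.c-fvar s' , bn e l'
  simT (bb e l) (C.c-bvar s) with _ , s' , l' ← simL l s = _ , C.c-bvar s' , bb e l'
  simT (app m l) (C.c-app₁ s) with _ , s' , m' ← simT m s = _ , C.c-app₁ s' , app m' l
  simT (app m l) (C.c-app₂ s) with _ , s' , l' ← simL l s = _ , C.c-app₂ s' , app m l'
  simT (esub p a m) (C.c-esub₁ s) with _ , s' , p' ← simT p s = _ , C.c-esub₁ s' , esub p' a m
  simT (esub p a m) (C.c-esub₂ s) with _ , s' , a' ← simT a s = _ , C.c-esub₂ s' , esub p a' m
  simT (esub p a m) (C.c-esub₃ s) with _ , s' , m' ← simT m s = _ , C.c-esub₃ s' , esub p a m'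
  simL (cat (cons m l) l') C.r-cat-cons = _ , C.r-cat-cons , cons m (cat l l')
  simL (cat nil l) C.r-cat-nil = _ , C.r-cat-nil , l
  simL (cat (cat l l') l'') C.r-cat-cat = _ , C.r-cat-cat , cat l (cat l' l'')
  simL (cat l nil) C.r-cat-nilr = _ , C.r-cat-nilr , l
  simL (lsub p g nil) C.r-s-nil = _ , C.r-s-nil , nil
  simL (lsub p g (cons m l)) C.r-s-cons = _ , C.r-s-cons , cons (esub p g m) (lsub p g l)
  simL (lsub p g (cat l l')) C.r-s-cat = _ , C.r-s-cat , cat (lsub p g l) (lsub p g l')
  simL (cons m l) (C.c-cons₁ s) with _ , s' , m' ← simT m s = _ , C.c-cons₁ s' , cons m' l
  simL (cons m l) (C.c-cons₂ s) with _ , s' , l' ← simL l s = _ , C.c-cons₂ s' , cons m l'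
  simL (cat m l) (C.c-cat₁ s) with _ , s' , m' ← simL m s = _ , C.c-cat₁ s' , cat m' l
  simL (cat m l) (C.c-cat₂ s) with _ , s' , l' ← simL l s = _ , C.c-cat₂ s' , cat m l'
  simL (lsub p a m) (C.c-lsub₁ s) with _ , s' , p' ← simT p s = _ , C.c-lsub₁ s' , lsub p' a m
  simL (lsub p a m) (C.c-lsub₂ s) with _ , s' , a' ← simT a s = _ , C.c-lsub₂ s' , lsub p a' m
  simL (lsub p a m) (C.c-lsub₃ s) with _ , s' , m' ← simL m s = _ , C.c-lsub₃ s' , lsub p a m'

  SNL : C.Ls → Set
  SNL = Acc (λ k l → l ⟶l k)

  SN-rel : ∀ {R M M'} → RelT R M' M → C.SN M → C.SN M'
  SN-rel q (acc r) = acc λ s → let _ , s' , q' = simT q s in SN-rel q' (r s')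

  SNL-rel : ∀ {R l l'} → RelL R l' l → SNL l → SNL l'
  SNL-rel q (acc r) = acc λ s → let _ , s' , q' = simL q s in SNL-rel q' (r s')

  SN-hren : ∀ f {M} → C.SN M → C.SN (hrenT f M)
  SN-hren f = SN-rel (rel-cographT {λ h h' → h ≡ f h'} (λ _ → refl) _)

  SNL-hren : ∀ f {l} → SNL l → SNL (hrenL f l)
  SNL-hren f = SNL-rel (rel-cographL {λ h h' → h ≡ f h'} (λ _ → refl) _)

  -- Leads from an opened body, which the typing rules speak of, back to the body under its binder.
  SN-unhren : ∀ f {M} → C.SN (hrenT f M) → C.SN M
  SN-unhren f = SN-rel (rel-graphT {λ h h' → h' ≡ f h} (λ _ → refl) _)

-- Termination of a reduction joined with a subterm order.

module AccUnion {A : Set} (_⟶_ _▷_ : A → A → Set)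
  (comm : ∀ {t u u'} → t ▷ u → u ⟶ u' → ∃[ t' ] (t ⟶ t' × t' ▷ u'))
  (wf : WellFounded (flip _▷_)) where

  infix 4 _≻_
  data _≻_ (t u : A) : Set where
    step : t ⟶ u → t ≻ u
    subt : t ▷ u → t ≻ u

  comm* : ∀ {t u u'} → Star _▷_ t u → u ⟶ u' → ∃[ t' ] (t ⟶ t' × Star _▷_ t' u')
  comm* refl*   s = _ , s , refl*
  comm* (d ◅ r) s with _ , s₁ , r₁ ← comm* r s with _ , s₂ , d₂ ← comm d s₁ = _ , s₂ , d₂ ◅ r₁

  -- The current element is kept below a root `t`. A step inside it lifts to a step of the root,
  -- which decreases; a descent keeps the root and decreases in the subterm order, whose
  -- accessibility restarts after every step.
  acc-∪ : ∀ {t} → Acc (flip _⟶_) t → Acc (flip _≻_) t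
  acc-∪ {t} a = go a (wf t) refl*
    where
    go : ∀ {t u} → Acc (flip _⟶_) t → Acc (flip _▷_) u → Star _▷_ t u → Acc (flip _≻_) u
    go′ : ∀ {t u} → Acc (flip _⟶_) t → Acc (flip _▷_) u → Star _▷_ t u → ∀ {v} → u ≻ v → Acc (flip _≻_) v
    go a b r = acc (go′ a b r)
    go′ (acc a) b       r (step s) with _ , s' , r' ← comm* r s = go (a s') (wf _) r'
    go′ a       (acc b) r (subt d) = go a (b d) (r ◅◅ d ◅ refl*)

-- Executing explicit substitutions.

module Translation (S : Set) (Ax : S → S → Set) (Rl : S → S → S → Set) where
  open Substitutions S Ax Rl
  open HeadRenaming S Ax Rl
  open C using (pi; lam; srt; fvar; bvar; app; esub; nil; cons; cat; lsub; _⟶t_; _⟶l_)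
  open P using (var; bvar; srt; pi; lam; app; _⟶β_; _[_])

  apps : P.Tm → List P.Tm → P.Tm
  apps t []       = t
  apps t (u ∷ us) = apps (app t u) us

  -- A list stands for the arguments it supplies to a head, so that reassociating applications or
  -- concatenations leaves the image unchanged.
  ℬ  : C.Tm → P.Tm
  ℬL : C.Ls → List P.Tm
  ℬ (pi A B)      = pi (ℬ A) (ℬ B)
  ℬ (lam A M)     = lam (ℬ A) (ℬ M)
  ℬ (srt s)       = srt s
  ℬ (fvar x l)    = apps (var x) (ℬL l)
  ℬ (bvar i l)    = apps (bvar i) (ℬL l)
  ℬ (app M l)     = apps (ℬ M) (ℬL l)
  ℬ (esub P A M)  = ℬ M [ ℬ P ]
  ℬL nil          = []
  ℬL (cons M l)   = ℬ M ∷ ℬL l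
  ℬL (cat l l')   = ℬL l ++ ℬL l'
  ℬL (lsub P A l) = map (_[ ℬ P ]) (ℬL l)

  ren-apps : ∀ f t us → ren f (apps t us) ≡ apps (ren f t) (map (ren f) us)
  ren-apps f t []       = refl
  ren-apps f t (u ∷ us) = ren-apps f (app t u) us

  sub-apps : ∀ σ t us → sub σ (apps t us) ≡ apps (sub σ t) (map (sub σ) us)
  sub-apps σ t []       = refl
  sub-apps σ t (u ∷ us) = sub-apps σ (app t u) us

  []-apps : ∀ v t us → apps t us [ v ] ≡ apps (t [ v ]) (map (_[ v ]) us)
  []-apps v t []       = refl
  []-apps v t (u ∷ us) = []-apps v (app t u) us

  apps-++ : ∀ t us vs → apps (apps t us) vs ≡ apps t (us ++ vs)
  apps-++ t []       vs = refl
  apps-++ t (u ∷ us) vs = apps-++ (app t u) us vs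

  ℬ-mk : ∀ h l → ℬ (mk h l) ≡ apps (atom h) (ℬL l)
  ℬ-mk (nm x) l = refl
  ℬ-mk (bd i) l = refl

  ℬ-hren  : ∀ f M → ℬ (hrenT f M) ≡ ren f (ℬ M)
  ℬL-hren : ∀ f l → ℬL (hrenL f l) ≡ map (ren f) (ℬL l)
  ℬ-hren f (pi A B)      = cong₂ pi (ℬ-hren f A) (ℬ-hren (liftr f) B)
  ℬ-hren f (lam A M)     = cong₂ lam (ℬ-hren f A) (ℬ-hren (liftr f) M)
  ℬ-hren f (srt s)       = refl
  ℬ-hren f (fvar x l)    = trans (ℬ-mk (f (nm x)) (hrenL f l))
    (trans (cong (apps _) (ℬL-hren f l)) (sym (ren-apps f (var x) (ℬL l))))
  ℬ-hren f (bvar i l)    = trans (ℬ-mk (f (bd i)) (hrenL f l))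
    (trans (cong (apps _) (ℬL-hren f l)) (sym (ren-apps f (bvar i) (ℬL l))))
  ℬ-hren f (app M l)     = trans (cong₂ apps (ℬ-hren f M) (ℬL-hren f l)) (sym (ren-apps f (ℬ M) (ℬL l)))
  ℬ-hren f (esub P A M)  = trans (cong₂ _[_] (ℬ-hren (liftr f) M) (ℬ-hren f P)) (sym (ren-[]-comm f (ℬ M) (ℬ P)))
  ℬL-hren f nil          = refl
  ℬL-hren f (cons M l)   = cong₂ _∷_ (ℬ-hren f M) (ℬL-hren f l)
  ℬL-hren f (cat l l')   = trans (cong₂ _++_ (ℬL-hren f l) (ℬL-hren f l')) (sym (map-++ (ren f) (ℬL l) (ℬL l')))
  ℬL-hren f (lsub P A l) = begin
    map (_[ ℬ (hrenT f P) ]) (ℬL (hrenL (liftr f) l))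
      ≡⟨ cong₂ (λ p → map (_[ p ])) (ℬ-hren f P) (ℬL-hren (liftr f) l) ⟩
    map (_[ ren f (ℬ P) ]) (map (ren (liftr f)) (ℬL l))
      ≡⟨ map-∘ (ℬL l) ⟨
    map (λ t → ren (liftr f) t [ ren f (ℬ P) ]) (ℬL l)
      ≡⟨ map-cong (λ t → sym (ren-[]-comm f t (ℬ P))) (ℬL l) ⟩
    map (λ t → ren f (t [ ℬ P ])) (ℬL l)
      ≡⟨ map-∘ (ℬL l) ⟩
    map (ren f) (map (_[ ℬ P ]) (ℬL l)) ∎
    where open ≡-Reasoning

  ℬ-shift : ∀ M → ℬ (C.shiftT 0 M) ≡ P.shift 0 (ℬ M)
  ℬ-shift M = trans (cong ℬ (shiftT-hren M)) (trans (ℬ-hren ↑h M) (sym (shift-as-ren 0 (ℬ M))))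

  -- Under a binder the PTSC swaps the two innermost indices and still substitutes for index 0,
  -- whereas `P.subst` moves on to index 1. The two conventions agree.
  swap-[] : ∀ p t → ren swapH t [ P.shift 0 p ] ≡ P.subst 1 (P.shift 0 p) t
  swap-[] p t = trans ([]-as-sub (ren swapH t) (P.shift 0 p)) (trans (sub-ren (P.shift 0 p • atom) swapH t)
    (trans (sub-cong pt t) (sym (subst-as-sub 1 (P.shift 0 p) t))))
    where
    pt : ∀ h → (P.shift 0 p • atom) (swapH h) ≡ substH 1 (P.shift 0 p) h
    pt (nm x)             = refl
    pt (bd 0)             = refl
    pt (bd 1)             = refl
    pt (bd (suc (suc i))) = refl

  ℬ-under : ∀ P M → ℬ (C.swapT 0 M) [ ℬ (C.shiftT 0 P) ] ≡ P.subst 1 (P.shift 0 (ℬ P)) (ℬ M)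
  ℬ-under P M = trans (cong₂ _[_] (trans (cong ℬ (swapT-hren M)) (ℬ-hren swapH M)) (ℬ-shift P))
                      (swap-[] (ℬ P) (ℬ M))

  _⟶β*s_ : List P.Tm → List P.Tm → Set
  _⟶β*s_ = Pointwise _⟶β*_

  apps-head : ∀ {t t'} us → t ⟶β t' → apps t us ⟶β apps t' us
  apps-head []       r = r
  apps-head (u ∷ us) r = apps-head us (P.c-app₁ r)

  apps* : ∀ {t t' us us'} → t ⟶β* t' → us ⟶β*s us' → apps t us ⟶β* apps t' us'
  apps* r []       = r
  apps* r (q ∷ qs) = apps* (app* r q) qs

  refl*s : ∀ {us} → us ⟶β*s us
  refl*s = Pw.refl refl*

  ≡⇒* : ∀ {t u} → t ≡ u → t ⟶β* u
  ≡⇒* refl = refl*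

  ≡⇒*s : ∀ {us vs} → us ≡ vs → us ⟶β*s vs
  ≡⇒*s refl = refl*s

  -- Only `r-beta` produces a β-step at the root; all other root rules are identities on images.
  -- Steps inside a substituted term may be copied or erased, so only a many-step reduction can be
  -- claimed.
  soundT : ∀ {M N} → M ⟶t N → ℬ M ⟶β* ℬ N
  soundL : ∀ {l k} → l ⟶l k → ℬL l ⟶β*s ℬL k
  soundT (C.r-beta {l = l}) = apps-head (ℬL l) P.beta ◅ refl*
  soundT C.r-nil = refl*
  soundT (C.r-fvar {x} {l} {l'}) = ≡⇒* (apps-++ (var x) (ℬL l) (ℬL l'))
  soundT (C.r-bvar {i} {l} {l'}) = ≡⇒* (apps-++ (bvar i) (ℬL l) (ℬL l'))
  soundT (C.r-app {M} {l} {l'}) = ≡⇒* (apps-++ (ℬ M) (ℬL l) (ℬL l'))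
  soundT (C.r-s-lam {P} {G} {A} {M}) = ≡⇒* (cong (lam _) (sym (ℬ-under P M)))
  soundT (C.r-s-hit {P} {G} {l}) = ≡⇒* ([]-apps (ℬ P) (bvar 0) (ℬL l))
  soundT (C.r-s-bvar {P} {G} {i} {l}) = ≡⇒* ([]-apps (ℬ P) (bvar (suc i)) (ℬL l))
  soundT (C.r-s-fvar {P} {G} {x} {l}) = ≡⇒* ([]-apps (ℬ P) (var x) (ℬL l))
  soundT (C.r-s-app {P} {G} {M} {l}) = ≡⇒* ([]-apps (ℬ P) (ℬ M) (ℬL l))
  soundT (C.r-s-pi {P} {G} {A} {B}) = ≡⇒* (cong (pi _) (sym (ℬ-under P B)))
  soundT C.r-s-srt = refl*
  soundT (C.c-pi₁ s) = pi* (soundT s) refl*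
  soundT (C.c-pi₂ s) = pi* refl* (soundT s)
  soundT (C.c-lam₁ s) = lam* (soundT s) refl*
  soundT (C.c-lam₂ s) = lam* refl* (soundT s)
  soundT (C.c-fvar s) = apps* refl* (soundL s)
  soundT (C.c-bvar s) = apps* refl* (soundL s)
  soundT (C.c-app₁ {l = l} s) = apps* (soundT s) (refl*s {ℬL l})
  soundT (C.c-app₂ {M} s) = apps* (refl* {x = ℬ M}) (soundL s)
  soundT (C.c-esub₁ {M = M} s) = []-*₂ (ℬ M) (soundT s)
  soundT (C.c-esub₂ s) = refl*
  soundT (C.c-esub₃ {P} s) = []-*₁ (ℬ P) (soundT s)
  soundL C.r-cat-cons = refl*s
  soundL C.r-cat-nil = refl*s
  soundL (C.r-cat-cat {l} {l'} {l''}) = ≡⇒*s (++-assoc (ℬL l) (ℬL l') (ℬL l''))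
  soundL (C.r-cat-nilr {l}) = ≡⇒*s (++-identityʳ (ℬL l))
  soundL C.r-s-nil = []
  soundL C.r-s-cons = refl*s
  soundL (C.r-s-cat {P} {G} {l} {l'}) =
    ≡⇒*s (map-++ (_[ ℬ P ]) (ℬL l) (ℬL l'))
  soundL (C.c-cons₁ s) = soundT s ∷ refl*s
  soundL (C.c-cons₂ s) = refl* ∷ soundL s
  soundL (C.c-cat₁ s) = Pw.++⁺ (soundL s) refl*s
  soundL (C.c-cat₂ {l₁} s) = Pw.++⁺ (refl*s {ℬL l₁}) (soundL s)
  soundL (C.c-lsub₁ {l = l} s) = Pw.map⁺ _ _ (Pw.refl (λ {t} → []-*₂ t (soundT s)))
  soundL (C.c-lsub₂ s) = refl*s
  soundL (C.c-lsub₃ {P} s) = Pw.map⁺ _ _ (Pw.map ([]-*₁ (ℬ P)) (soundL s))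

-- Strong normalisation of PTSC expressions from their components and images.

module Normalisation (S : Set) (Ax : S → S → Set) (Rl : S → S → S → Set) where
  open Substitutions S Ax Rl
  open HeadRenaming S Ax Rl
  open Translation S Ax Rl
  open C using (pi; lam; srt; fvar; bvar; app; esub; nil; cons; cat; lsub; _⟶t_; _⟶l_; SN)
  open P using (var; bvar; srt; pi; lam; app; _⟶β_; _[_])

  infix 4 _▷_
  data _▷_ : P.Tm → P.Tm → Set where
    pi₁  : ∀ {U T} → pi U T ▷ U
    pi₂  : ∀ {U T} → pi U T ▷ T
    lam₁ : ∀ {U t} → lam U t ▷ U
    lam₂ : ∀ {U t} → lam U t ▷ t
    app₁ : ∀ {t u} → app t u ▷ t
    app₂ : ∀ {t u} → app t u ▷ u

  ▷-comm : ∀ {t u u'} → t ▷ u → u ⟶β u' → ∃[ t' ] (t ⟶β t' × t' ▷ u')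
  ▷-comm pi₁ s = _ , P.c-pi₁ s , pi₁
  ▷-comm pi₂ s = _ , P.c-pi₂ s , pi₂
  ▷-comm lam₁ s = _ , P.c-lam₁ s , lam₁
  ▷-comm lam₂ s = _ , P.c-lam₂ s , lam₂
  ▷-comm app₁ s = _ , P.c-app₁ s , app₁
  ▷-comm app₂ s = _ , P.c-app₂ s , app₂

  ▷-wf : WellFounded (flip _▷_)
  ▷-wf (var x)   = acc λ ()
  ▷-wf (bvar i)  = acc λ ()
  ▷-wf (srt s)   = acc λ ()
  ▷-wf (pi U T)  = acc λ { pi₁ → ▷-wf U ; pi₂ → ▷-wf T }
  ▷-wf (lam U t) = acc λ { lam₁ → ▷-wf U ; lam₂ → ▷-wf t }
  ▷-wf (app t u) = acc λ { app₁ → ▷-wf t ; app₂ → ▷-wf u }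

  open AccUnion _⟶β_ _▷_ ▷-comm ▷-wf

  Expr : Set
  Expr = C.Tm ⊎ C.Ls

  data _⟶e_ : Expr → Expr → Set where
    tm : ∀ {M N} → M ⟶t N → inj₁ M ⟶e inj₁ N
    ls : ∀ {l k} → l ⟶l k → inj₂ l ⟶e inj₂ k

  -- An explicit substitution has no immediate subexpressions here: no root rule takes one apart
  -- when it is the head of an application, the left part of a concatenation or the body of another
  -- substitution.
  data _▷e_ : Expr → Expr → Set where
    pi₁   : ∀ {A B} → inj₁ (pi A B) ▷e inj₁ A
    pi₂   : ∀ {A B} → inj₁ (pi A B) ▷e inj₁ B
    lam₁  : ∀ {A B} → inj₁ (lam A B) ▷e inj₁ A
    lam₂  : ∀ {A B} → inj₁ (lam A B) ▷e inj₁ B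
    fvar  : ∀ {x l} → inj₁ (fvar x l) ▷e inj₂ l
    bvar  : ∀ {i l} → inj₁ (bvar i l) ▷e inj₂ l
    app₁  : ∀ {M l} → inj₁ (app M l) ▷e inj₁ M
    app₂  : ∀ {M l} → inj₁ (app M l) ▷e inj₂ l
    cons₁ : ∀ {M l} → inj₂ (cons M l) ▷e inj₁ M
    cons₂ : ∀ {M l} → inj₂ (cons M l) ▷e inj₂ l
    cat₁  : ∀ {l k} → inj₂ (cat l k) ▷e inj₂ l
    cat₂  : ∀ {l k} → inj₂ (cat l k) ▷e inj₂ k

  ▷e-comm : ∀ {t u u'} → t ▷e u → u ⟶e u' → ∃[ t' ] (t ⟶e t' × t' ▷e u')
  ▷e-comm pi₁   (tm s) = _ , tm (C.c-pi₁ s) , pi₁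
  ▷e-comm pi₂   (tm s) = _ , tm (C.c-pi₂ s) , pi₂
  ▷e-comm lam₁  (tm s) = _ , tm (C.c-lam₁ s) , lam₁
  ▷e-comm lam₂  (tm s) = _ , tm (C.c-lam₂ s) , lam₂
  ▷e-comm fvar  (ls s) = _ , tm (C.c-fvar s) , fvar
  ▷e-comm bvar  (ls s) = _ , tm (C.c-bvar s) , bvar
  ▷e-comm app₁  (tm s) = _ , tm (C.c-app₁ s) , app₁
  ▷e-comm app₂  (ls s) = _ , tm (C.c-app₂ s) , app₂
  ▷e-comm cons₁ (tm s) = _ , ls (C.c-cons₁ s) , cons₁
  ▷e-comm cons₂ (ls s) = _ , ls (C.c-cons₂ s) , cons₂
  ▷e-comm cat₁  (ls s) = _ , ls (C.c-cat₁ s) , cat₁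
  ▷e-comm cat₂  (ls s) = _ , ls (C.c-cat₂ s) , cat₂

  ▷e-wfT : ∀ M → Acc (flip _▷e_) (inj₁ M)
  ▷e-wfL : ∀ l → Acc (flip _▷e_) (inj₂ l)
  ▷e-wfT (pi A B)     = acc λ { pi₁ → ▷e-wfT A ; pi₂ → ▷e-wfT B }
  ▷e-wfT (lam A B)    = acc λ { lam₁ → ▷e-wfT A ; lam₂ → ▷e-wfT B }
  ▷e-wfT (srt s)      = acc λ ()
  ▷e-wfT (fvar x l)   = acc λ { fvar → ▷e-wfL l }
  ▷e-wfT (bvar i l)   = acc λ { bvar → ▷e-wfL l }
  ▷e-wfT (app M l)    = acc λ { app₁ → ▷e-wfT M ; app₂ → ▷e-wfL l }
  ▷e-wfT (esub P A M) = acc λ ()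
  ▷e-wfL nil          = acc λ ()
  ▷e-wfL (cons M l)   = acc λ { cons₁ → ▷e-wfT M ; cons₂ → ▷e-wfL l }
  ▷e-wfL (cat l k)    = acc λ { cat₁ → ▷e-wfL l ; cat₂ → ▷e-wfL k }
  ▷e-wfL (lsub P A l) = acc λ ()

  ▷e-wf : WellFounded (flip _▷e_)
  ▷e-wf (inj₁ M) = ▷e-wfT M
  ▷e-wf (inj₂ l) = ▷e-wfL l

  module E = AccUnion _⟶e_ _▷e_ ▷e-comm ▷e-wf

  -- Strong normalisation with descent to subexpressions, so that one induction covers both inner
  -- reductions and rules that take an expression apart.
  SNE : Expr → Set
  SNE = Acc (flip E._≻_)

  SN⇒SNE : ∀ {M} → SN M → SNE (inj₁ M)
  SN⇒SNE = E.acc-∪ ∘ go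
    where
    go : ∀ {M} → SN M → Acc (flip _⟶e_) (inj₁ M)
    go (acc r) = acc λ { (tm s) → go (r s) }

  SNL⇒SNE : ∀ {l} → SNL l → SNE (inj₂ l)
  SNL⇒SNE = E.acc-∪ ∘ go
    where
    go : ∀ {l} → SNL l → Acc (flip _⟶e_) (inj₂ l)
    go (acc r) = acc λ { (ls s) → go (r s) }

  SNE⇒SN : ∀ {M} → SNE (inj₁ M) → SN M
  SNE⇒SN (acc r) = acc λ s → SNE⇒SN (r (E.step (tm s)))

  SNE⇒SNL : ∀ {l} → SNE (inj₂ l) → SNL l
  SNE⇒SNL (acc r) = acc λ s → SNE⇒SNL (r (E.step (ls s)))

  sn-subT : ∀ {e M} → SNE e → e ▷e inj₁ M → SN M
  sn-subT (acc r) d = SNE⇒SN (r (E.subt d))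

  sn-subL : ∀ {e l} → SNE e → e ▷e inj₂ l → SNL l
  sn-subL (acc r) d = SNE⇒SNL (r (E.subt d))

  SN-srt : ∀ {s} → SN (srt s)
  SN-srt = acc λ ()

  SN-pi : ∀ {A B} → SN A → SN B → SN (pi A B)
  SN-pi (acc a) (acc b) = acc λ { (C.c-pi₁ s) → SN-pi (a s) (acc b) ; (C.c-pi₂ s) → SN-pi (acc a) (b s) }

  SN-lam : ∀ {A B} → SN A → SN B → SN (lam A B)
  SN-lam (acc a) (acc b) = acc λ { (C.c-lam₁ s) → SN-lam (a s) (acc b) ; (C.c-lam₂ s) → SN-lam (acc a) (b s) }

  SN-fvar : ∀ {x l} → SNL l → SN (fvar x l)
  SN-fvar (acc a) = acc λ { (C.c-fvar s) → SN-fvar (a s) }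

  SN-bvar : ∀ {i l} → SNL l → SN (bvar i l)
  SN-bvar (acc a) = acc λ { (C.c-bvar s) → SN-bvar (a s) }

  SNL-nil : SNL nil
  SNL-nil = acc λ ()

  SNL-cons : ∀ {M l} → SN M → SNL l → SNL (cons M l)
  SNL-cons (acc a) (acc b) = acc λ { (C.c-cons₁ s) → SNL-cons (a s) (acc b) ; (C.c-cons₂ s) → SNL-cons (acc a) (b s) }

  -- Lexicographic induction, the first list with descent and then the second. Reassociation makes
  -- two calls, both with a smaller first list, so the second list is free to grow.
  SNL-cat : ∀ {l k} → SNL l → SNL k → SNL (cat l k)
  SNL-cat = go ∘ SNL⇒SNE
    where
    go : ∀ {l k} → SNE (inj₂ l) → SNL k → SNL (cat l k)
    go′ : ∀ {l k m} → SNE (inj₂ l) → SNL k → cat l k ⟶l m → SNL m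
    go a b = acc (go′ a b)
    go′ (acc a) b       C.r-cat-cons = SNL-cons (SNE⇒SN (a (E.subt cons₁))) (go (a (E.subt cons₂)) b)
    go′ a       b       C.r-cat-nil  = b
    go′ (acc a) b       C.r-cat-cat  = go (a (E.subt cat₁)) (go (a (E.subt cat₂)) b)
    go′ a       b       C.r-cat-nilr = SNE⇒SNL a
    go′ (acc a) b       (C.c-cat₁ s) = go (a (E.step (ls s))) b
    go′ a       (acc b) (C.c-cat₂ s) = go a (b s)

  infix 4 _≽_ _≻⁺_
  _≽_ : P.Tm → P.Tm → Set
  _≽_ = Star _≻_

  _≻⁺_ : P.Tm → P.Tm → Set
  t ≻⁺ u = ∃[ v ] (t ≻ v × v ≽ u)

  ≽-≻ : ∀ {t u v} → t ≽ u → u ≻ v → t ≻⁺ v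
  ≽-≻ refl*   q = _ , q , refl*
  ≽-≻ (p ◅ r) q = _ , p , r ◅◅ q ◅ refl*

  ≻⁺-≽ : ∀ {t u v} → t ≻⁺ u → u ≽ v → t ≻⁺ v
  ≻⁺-≽ (_ , p , r) q = _ , p , r ◅◅ q

  β*⇒≽ : ∀ {t u} → t ⟶β* u → t ≽ u
  β*⇒≽ = gmap (λ t → t) step

  ≽-β* : ∀ {t u v} → t ≽ u → u ⟶β* v → t ≽ v
  ≽-β* p q = p ◅◅ β*⇒≽ q

  apps-≽-head : ∀ h us → apps h us ≽ h
  apps-≽-head h []       = refl*
  apps-≽-head h (u ∷ us) = apps-≽-head (app h u) us ◅◅ subt app₁ ◅ refl*

  -- Each argument is a proper subterm of the spine, hence strictly below `t` even when `t` is the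
  -- spine itself.
  apps-args : ∀ {t} h us → t ≽ apps h us → All (t ≻⁺_) us
  apps-args h []       p = []
  apps-args h (u ∷ us) p = ≽-≻ (p ◅◅ apps-≽-head (app h u) us) (subt app₂) ∷ apps-args (app h u) us p

  All-β* : ∀ {t us vs} → us ⟶β*s vs → All (t ≻⁺_) us → All (t ≻⁺_) vs
  All-β* []       []       = []
  All-β* (r ∷ rs) (p ∷ ps) = ≻⁺-≽ p (β*⇒≽ r) ∷ All-β* rs ps

  -- The bound is ≽ and not equality, since inner reductions may leave the image unchanged
  -- or reduce it.
  SN-app-below SN-esub-below : P.Tm → Set
  SN-app-below t  = ∀ {M l} → SN M → SNL l → t ≽ ℬ (app M l) → SN (app M l)
  SN-esub-below t = ∀ {P G M} → SN P → SN G → SN M → t ≽ ℬ (esub P G M) → SN (esub P G M)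

  -- One stage of the induction on the bound: `app<` and `esub<` are the hypotheses for everything
  -- strictly below `t`, and the lemmas inside run their own inductions at the fixed bound `t`.
  module Level (t : P.Tm) (app< : ∀ {v} → t ≻ v → SN-app-below v)
                          (esub< : ∀ {v} → t ≻ v → SN-esub-below v) where

    esub<⁺ : ∀ {P G M} → SN P → SN G → SN M → t ≻⁺ ℬ (esub P G M) → SN (esub P G M)
    esub<⁺ p g m (_ , q , r) = esub< q p g m r

    -- The entries have images strictly below `t`, so a substitution pushed into an entry falls
    -- under the hypothesis. This case therefore stands before `SN-esub` instead of being mutual
    -- with it.
    SN-lsub : ∀ {P G l} → SN P → SN G → SNE (inj₂ l) → All (t ≻⁺_) (ℬL (lsub P G l)) → SNL (lsub P G l)
    SN-lsub′ : ∀ {P G l k} → SN P → SN G → SNE (inj₂ l) → All (t ≻⁺_) (ℬL (lsub P G l)) →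
               lsub P G l ⟶l k → SNL k
    SN-lsub p g m q = acc (SN-lsub′ p g m q)
    SN-lsub′ p g m q C.r-s-nil = SNL-nil
    SN-lsub′ p g (acc m) (q ∷ qs) C.r-s-cons =
      SNL-cons (esub<⁺ p g (SNE⇒SN (m (E.subt cons₁))) q) (SN-lsub p g (m (E.subt cons₂)) qs)
    SN-lsub′ p g (acc m) q (C.r-s-cat {P} {G} {l} {l'}) =
      SNL-cat (SN-lsub p g (m (E.subt cat₁)) (++⁻ˡ _ q')) (SN-lsub p g (m (E.subt cat₂)) (++⁻ʳ (map (_[ ℬ P ]) (ℬL l)) q'))
      where q' = subst (All (t ≻⁺_)) (map-++ (_[ ℬ P ]) (ℬL l) (ℬL l')) q
    SN-lsub′ (acc p) g m q s₀@(C.c-lsub₁ s) = SN-lsub (p s) g m (All-β* (soundL s₀) q)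
    SN-lsub′ p (acc g) m q (C.c-lsub₂ s) = SN-lsub p (g s) m q
    SN-lsub′ p g (acc m) q s₀@(C.c-lsub₃ s) = SN-lsub p g (m (E.step (ls s))) (All-β* (soundL s₀) q)

    SN-app : ∀ {M l} → SNE (inj₁ M) → SNL l → t ≽ ℬ (app M l) → SN (app M l)
    SN-app′ : ∀ {M l N} → SNE (inj₁ M) → SNL l → t ≽ ℬ (app M l) → app M l ⟶t N → SN N
    SN-app m n q = acc (SN-app′ m n q)
    -- Here the bound drops to `v`. The new head is a substitution whose image heads the spine below
    -- `v`, so both hypotheses are taken at `v`.
    SN-app′ m n q (C.r-beta {A} {M} {N} {l}) with v , r , q' ← ≽-≻ q (step (apps-head (ℬL l) P.beta)) =
      app< r (esub< r (sn-subT n' cons₁) (sn-subT m lam₁) (sn-subT m lam₂) (q' ◅◅ apps-≽-head _ (ℬL l)))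
           (sn-subL n' cons₂) q'
      where n' = SNL⇒SNE n
    SN-app′ m n q C.r-nil = SNE⇒SN m
    SN-app′ m n q C.r-fvar = SN-fvar (SNL-cat (sn-subL m fvar) n)
    SN-app′ m n q C.r-bvar = SN-bvar (SNL-cat (sn-subL m bvar) n)
    -- The image stays the same while the head becomes a subexpression; the head comes first in the
    -- order, so the list may grow.
    SN-app′ m₀@(acc m) n q s₀@C.r-app =
      SN-app (m (E.subt app₁)) (SNL-cat (sn-subL m₀ app₂) n) (≽-β* q (soundT s₀))
    SN-app′ (acc m) n q s₀@(C.c-app₁ s) = SN-app (m (E.step (tm s))) n (≽-β* q (soundT s₀))
    SN-app′ m (acc n) q s₀@(C.c-app₂ s) = SN-app m (n s) (≽-β* q (soundT s₀))

    -- `h` is the image of whatever the list is applied to; substituting in the whole spine shows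
    -- the entries of the substituted list to be arguments within the bound.
    lsub-of-head : ∀ {P G l} h → SN P → SN G → SNL l → t ≽ apps h (ℬL l) [ ℬ P ] → SNL (lsub P G l)
    lsub-of-head {P} {G} {l} h p g n q = SN-lsub p g (SNL⇒SNE n)
      (apps-args (h [ ℬ P ]) (ℬL (lsub P G l)) (subst (t ≽_) ([]-apps (ℬ P) h (ℬL l)) q))

    -- Passing to the body of a binder is a strict decrease of the image, so the shifted and swapped
    -- components, normalising because they are renamings, are covered by the hypothesis.
    SN-esub-binder : ∀ {P G M} → SN P → SN G → SN M → t ≻⁺ P.subst 1 (P.shift 0 (ℬ P)) (ℬ M) →
                     SN (esub (C.shiftT 0 P) (C.shiftT 0 G) (C.swapT 0 M))
    SN-esub-binder {P} {G} {M} p g m q =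
      esub<⁺ (shifted p) (shifted g) (subst SN (sym (swapT-hren M)) (SN-hren swapH m))
             (subst (t ≻⁺_) (sym (ℬ-under P M)) q)
      where
      shifted : ∀ {M} → SN M → SN (C.shiftT 0 M)
      shifted {M} m = subst SN (sym (shiftT-hren M)) (SN-hren ↑h m)

    -- A substitution may turn into an application at the same bound, as in `r-s-hit`, but `SN-app`
    -- reaches substitutions only at smaller bounds. Hence the two need no mutual recursion at `t`.
    SN-esub : ∀ {P G M} → SN P → SN G → SNE (inj₁ M) → t ≽ ℬ (esub P G M) → SN (esub P G M)
    SN-esub′ : ∀ {P G M N} → SN P → SN G → SNE (inj₁ M) → t ≽ ℬ (esub P G M) →
               esub P G M ⟶t N → SN N
    SN-esub p g m q = acc (SN-esub′ p g m q)
    SN-esub′ p g m q C.r-s-lam =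
      SN-lam (esub<⁺ p g (sn-subT m lam₁) (≽-≻ q (subt lam₁)))
             (SN-esub-binder p g (sn-subT m lam₂) (≽-≻ q (subt lam₂)))
    SN-esub′ p g m q C.r-s-pi =
      SN-pi (esub<⁺ p g (sn-subT m pi₁) (≽-≻ q (subt pi₁)))
            (SN-esub-binder p g (sn-subT m pi₂) (≽-≻ q (subt pi₂)))
    SN-esub′ p g m q s₀@C.r-s-hit =
      SN-app (SN⇒SNE p) (lsub-of-head (bvar 0) p g (sn-subL m bvar) q) (≽-β* q (soundT s₀))
    SN-esub′ p g m q (C.r-s-bvar {i = i}) = SN-bvar (lsub-of-head (bvar (suc i)) p g (sn-subL m bvar) q)
    SN-esub′ p g m q (C.r-s-fvar {x = x}) = SN-fvar (lsub-of-head (var x) p g (sn-subL m fvar) q)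
    -- The head is again a substitution, now into a subexpression; once it normalises, `SN-app`
    -- takes over at the same bound.
    SN-esub′ p g m₀@(acc m) q s₀@(C.r-s-app {P} {G} {M} {l}) =
      SN-app (SN⇒SNE (SN-esub p g (m (E.subt app₁)) (q' ◅◅ apps-≽-head _ (ℬL (lsub P G l)))))
             (lsub-of-head (ℬ M) p g (sn-subL m₀ app₂) q) q'
      where q' = ≽-β* q (soundT s₀)
    SN-esub′ p g m q C.r-s-srt = SN-srt
    SN-esub′ (acc p) g m q s₀@(C.c-esub₁ s) = SN-esub (p s) g m (≽-β* q (soundT s₀))
    -- The image does not see the annotation, so the decrease comes from the normalisation of `G`
    -- itself.
    SN-esub′ p (acc g) m q (C.c-esub₂ s) = SN-esub p (g s) m q
    SN-esub′ p g (acc m) q s₀@(C.c-esub₃ s) = SN-esub p g (m (E.step (tm s))) (≽-β* q (soundT s₀))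

  below : ∀ {t} → Acc (flip _≻_) t → SN-app-below t × SN-esub-below t
  below {t} (acc r) = (λ m n → L.SN-app (SN⇒SNE m) n) , (λ p g m → L.SN-esub p g (SN⇒SNE m))
    where module L = Level t (λ s → proj₁ (below (r s))) (λ s → proj₂ (below (r s)))

  SN-app : ∀ {M l} → P.SN (ℬ (app M l)) → SN M → SNL l → SN (app M l)
  SN-app a m n = proj₁ (below (acc-∪ a)) m n refl*

  SN-esub : ∀ {P G M} → P.SN (ℬ (esub P G M)) → SN P → SN G → SN M → SN (esub P G M)
  SN-esub a p g m = proj₂ (below (acc-∪ a)) p g m refl*

  -- A list has no single term as image; its entries are measured through the spine they form on a
  -- head `h`.
  SN-lsub : ∀ {P G l} h → P.SN (apps h (ℬL (lsub P G l))) → SN P → SN G → SNL l → SNL (lsub P G l)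
  SN-lsub {P} {G} {l} h a p g n with acc-∪ a
  ... | acc r = Level.SN-lsub _ (λ s → proj₁ (below (r s))) (λ s → proj₂ (below (r s)))
                  p g (SNL⇒SNE n) (apps-args h (ℬL (lsub P G l)) refl*)

-- The de Bruijn presentation of the PTS.

module DeBruijn (S : Set) (Ax : S → S → Set) (Rl : S → S → S → Set) where
  open Substitutions S Ax Rl
  open P using (Tm; bvar; srt; pi; lam; app; _[_]; _↔β*_)

  sub-conv : ∀ σ {t u} → t ↔β* u → sub σ t ↔β* sub σ u
  sub-conv σ = Eq.gmap (sub σ) (sub-β σ)

  data Lookup : List Tm → ℕ → Tm → Set where
    here  : ∀ {Γ U} → Lookup (U ∷ Γ) 0 (ren ↑h U)
    there : ∀ {Γ U i T} → Lookup Γ i T → Lookup (U ∷ Γ) (suc i) (ren ↑h T)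

  infix 3 _⊢_∶_
  -- In place of a well-formed context, `d-var` asks for a sort of the type it looks up. The
  -- premises of `d-app` are those from which the PTSC types a one-element argument list.
  data _⊢_∶_ (Γ : List Tm) : Tm → Tm → Set where
    d-var  : ∀ {i T s} → Lookup Γ i T → Γ ⊢ T ∶ srt s → Γ ⊢ bvar i ∶ T
    d-sort : ∀ {s s'} → Ax s s' → Γ ⊢ srt s ∶ srt s'
    d-pi   : ∀ {U T s₁ s₂ s₃} → Γ ⊢ U ∶ srt s₁ → U ∷ Γ ⊢ T ∶ srt s₂ → Rl s₁ s₂ s₃ → Γ ⊢ pi U T ∶ srt s₃
    d-lam  : ∀ {U T t s₁ s} → Γ ⊢ U ∶ srt s₁ → Γ ⊢ pi U T ∶ srt s → U ∷ Γ ⊢ t ∶ T → Γ ⊢ lam U t ∶ pi U T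
    d-app  : ∀ {t u U T s₁ s₂ s} → Γ ⊢ t ∶ pi U T → Γ ⊢ u ∶ U → Γ ⊢ pi U T ∶ srt s →
             Γ ⊢ U ∶ srt s₁ → U ∷ Γ ⊢ T ∶ srt s₂ → Γ ⊢ T [ u ] ∶ srt s₂ → Γ ⊢ app t u ∶ T [ u ]
    d-conv : ∀ {t U V s} → Γ ⊢ t ∶ U → Γ ⊢ V ∶ srt s → U ↔β* V → Γ ⊢ t ∶ V

  Fam : Set₁
  Fam = List Tm → Tm → Tm → Set

  -- Common to renamings and substitutions: the family K types the images of the variables.
  record Kit (K : Fam) : Set where
    field
      k-here : ∀ {Δ U} → K (U ∷ Δ) (bvar 0) (ren ↑h U)
      k-wk   : ∀ {Δ U t T} → K Δ t T → K (U ∷ Δ) (ren ↑h t) (ren ↑h T)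
      k-tm   : ∀ {Δ t T s} → K Δ t T → Δ ⊢ T ∶ srt s → Δ ⊢ t ∶ T

  Maps : Fam → List Tm → Sub → List Tm → Set
  Maps K Γ σ Δ = ∀ {i T} → Lookup Γ i T → K Δ (σ (bd i)) (sub σ T)

  module Apply {K : Fam} (kit : Kit K) where
    open Kit kit
    maps-lift : ∀ {Γ σ Δ U} → Maps K Γ σ Δ → Maps K (U ∷ Γ) (lifts σ) (sub σ U ∷ Δ)
    maps-lift {σ = σ} m (here {U = U}) = subst (K _ _) (sym (sub-lifts-↑ σ U)) k-here
    maps-lift {σ = σ} m (there {T = T} l) = subst (K _ _) (sym (sub-lifts-↑ σ T)) (k-wk (m l))

    maps-⊢ : ∀ {Γ Δ σ t T} → Γ ⊢ t ∶ T → Maps K Γ σ Δ → Δ ⊢ sub σ t ∶ sub σ T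
    maps-⊢ (d-var l d) m = k-tm (m l) (maps-⊢ d m)
    maps-⊢ (d-sort a) m = d-sort a
    maps-⊢ (d-pi d e r) m = d-pi (maps-⊢ d m) (maps-⊢ e (maps-lift m)) r
    maps-⊢ (d-lam d e f) m = d-lam (maps-⊢ d m) (maps-⊢ e m) (maps-⊢ f (maps-lift m))
    maps-⊢ {Δ = Δ} {σ = σ} (d-app {t} {u} {T = T} {s₂ = s₂} d e f g h k) m =
      subst (Δ ⊢ app (sub σ t) (sub σ u) ∶_) (sym (sub-[]-comm σ T u))
        (d-app (maps-⊢ d m) (maps-⊢ e m) (maps-⊢ f m) (maps-⊢ g m) (maps-⊢ h (maps-lift m))
          (subst (Δ ⊢_∶ srt s₂) (sub-[]-comm σ T u) (maps-⊢ k m)))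
    maps-⊢ {σ = σ} (d-conv d e c) m = d-conv (maps-⊢ d m) (maps-⊢ e m) (sub-conv σ c)

  IsVar : Fam
  IsVar Δ t T = ∃[ i ] (t ≡ bvar i × Lookup Δ i T)

  IsVar-kit : Kit IsVar
  IsVar-kit = record
    { k-here = _ , refl , here
    ; k-wk   = λ { (i , refl , l) → suc i , refl , there l }
    ; k-tm   = λ { (i , refl , l) d → d-var l d } }

  weaken : ∀ {Γ U t T} → Γ ⊢ t ∶ T → U ∷ Γ ⊢ ren ↑h t ∶ ren ↑h T
  weaken {Γ} {U} {t} {T} d = subst₂ (U ∷ Γ ⊢_∶_) (sym (ren-as-sub ↑h t)) (sym (ren-as-sub ↑h T))
    (Apply.maps-⊢ IsVar-kit d λ {i} {T} l → suc i , refl , subst (Lookup _ _) (ren-as-sub ↑h T) (there l))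

  -- Variables are kept apart from typed terms because `d-var` needs a sort for its type, which only
  -- the derivation being transported supplies, through `k-tm`.
  IsTm : Fam
  IsTm Δ t T = IsVar Δ t T ⊎ (Δ ⊢ t ∶ T)

  IsTm-kit : Kit IsTm
  IsTm-kit = record
    { k-here = inj₁ (Kit.k-here IsVar-kit)
    ; k-wk   = λ { (inj₁ v) → inj₁ (Kit.k-wk IsVar-kit v) ; (inj₂ d) → inj₂ (weaken d) }
    ; k-tm   = λ { (inj₁ v) e → Kit.k-tm IsVar-kit v e ; (inj₂ d) e → d } }

  ↑-[] : ∀ u T → sub (u • atom) (ren ↑h T) ≡ T
  ↑-[] u T = trans (•-↑ u atom T) (sub-id T)

  ⊢-[] : ∀ {Γ U u t T} → U ∷ Γ ⊢ t ∶ T → Γ ⊢ u ∶ U → Γ ⊢ t [ u ] ∶ T [ u ]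
  ⊢-[] {Γ} {U} {u} {t} {T} d e = subst₂ (Γ ⊢_∶_) (sym ([]-as-sub t u)) (sym ([]-as-sub T u))
    (Apply.maps-⊢ IsTm-kit d maps)
    where
    maps : Maps IsTm (U ∷ Γ) (u • atom) Γ
    maps here              = inj₂ (subst (Γ ⊢ u ∶_) (sym (↑-[] u U)) e)
    maps (there {T = T} l) = inj₁ (_ , refl , subst (Lookup Γ _) (sym (↑-[] u T)) l)

  pi-inv : ∀ {Γ U T V} → Γ ⊢ pi U T ∶ V → ∃[ s₁ ] ∃[ s₂ ] ((Γ ⊢ U ∶ srt s₁) × (U ∷ Γ ⊢ T ∶ srt s₂))
  pi-inv (d-pi d e r)   = _ , _ , d , e
  pi-inv (d-conv d e c) = pi-inv d

  type-correct : ∀ {Γ t T} → Γ ⊢ t ∶ T → (∃[ s ] T ≡ srt s) ⊎ (∃[ s ] Γ ⊢ T ∶ srt s)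
  type-correct (d-var l d)         = inj₂ (_ , d)
  type-correct (d-sort a)          = inj₁ (_ , refl)
  type-correct (d-pi d e r)        = inj₁ (_ , refl)
  type-correct (d-lam d e f)       = inj₂ (_ , e)
  type-correct (d-app d e f g h k) = inj₂ (_ , k)
  type-correct (d-conv d e c)      = inj₂ (_ , e)

  pi-type-correct : ∀ {Γ t U T} → Γ ⊢ t ∶ pi U T → ∃[ s ] Γ ⊢ pi U T ∶ srt s
  pi-type-correct d with type-correct d
  ... | inj₂ e = e

  app-intro : ∀ {Γ t u U T} → Γ ⊢ t ∶ pi U T → Γ ⊢ u ∶ U → Γ ⊢ app t u ∶ T [ u ]
  app-intro {u = u} {T = T} d e with _ , f ← pi-type-correct d with _ , _ , g , h ← pi-inv f = d-app d e f g h (⊢-[] h e)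

-- Interpreting named derivations by environments into the de Bruijn system.

module Interpretation (S : Set) (Ax : S → S → Set) (Rl : S → S → S → Set) where
  open Substitutions S Ax Rl
  open HeadRenaming S Ax Rl
  open Translation S Ax Rl
  open DeBruijn S Ax Rl
  open P using (Tm; var; bvar; srt; pi; lam; app; _⟶β_; _[_]; _↔β*_; ε; _▸_⦂_; dom)
  open C using (esub; nil; cons; cat; lsub; fvar; bvar; srt; pi; lam; app; ε; _▸_⦂_)

  -- Nothing is required of the images of dangling indices.
  Env : List Tm → Sub → P.Ctx → Set
  Env Δ σ Γ = ∀ {x A} → x P.⦂ A ∈ Γ → Δ ⊢ σ (nm x) ∶ sub σ A

  record Agree (Γ : P.Ctx) (σ τ : Sub) : Set where
    constructor agree
    field agrees : ∀ {x A} → x P.⦂ A ∈ Γ → σ (nm x) ≡ τ (nm x)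
  open Agree

  -- Semantic stand-in for having no undeclared names and no dangling indices: only the images of
  -- declared names can influence the result.
  Closed : P.Ctx → Tm → Set
  Closed Γ t = ∀ {σ τ} → Agree Γ σ τ → sub σ t ≡ sub τ t

  -- Quantifying over all environments builds in weakening and substitution, which the context
  -- inclusion and the substitution rules of the PTSC call for.
  _⊨_∶_ : P.Ctx → Tm → Tm → Set
  Γ ⊨ t ∶ T = ∀ {Δ σ} → Env Δ σ Γ → Δ ⊢ sub σ t ∶ sub σ T

  data SemWf : P.Ctx → Set where
    ε   : SemWf ε
    ext : ∀ {Γ x A s} → SemWf Γ → Γ ⊨ A ∶ srt s → Closed Γ A → x ∉ dom Γ → SemWf (Γ ▸ x ⦂ A)

  ∈-dom : ∀ {Γ x A} → x P.⦂ A ∈ Γ → x ∈ dom Γ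
  ∈-dom P.here      = here refl
  ∈-dom (P.there p) = there (∈-dom p)

  ∈-closed : ∀ {Γ x A} → SemWf Γ → x P.⦂ A ∈ Γ → Closed Γ A
  ∈-closed (ext w d c n) P.here      g = c (agree (agrees g ∘ P.there))
  ∈-closed (ext w d c n) (P.there p) g = ∈-closed w p (agree (agrees g ∘ P.there))

  upd : Name → Tm → (ℕ → Tm) → Sub → Sub
  upd x u b σ (nm y) = if y ≡ᵇ x then u else σ (nm y)
  upd x u b σ (bd i) = b i

  upd-hit : ∀ {A : Set} x {u v : A} → (if x ≡ᵇ x then u else v) ≡ u
  upd-hit x with x ≡ᵇ x | ≡⇒≡ᵇ x x refl
  ... | true | _ = refl

  upd-miss : ∀ {A : Set} x y {u v : A} → y ≢ x → (if y ≡ᵇ x then u else v) ≡ v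
  upd-miss x y ne with y ≡ᵇ x | ≡ᵇ⇒≡ y x
  ... | true  | f = ⊥-elim (ne (f tt))
  ... | false | f = refl

  fresh-≢ : ∀ {Γ x y A} → x ∉ dom Γ → y P.⦂ A ∈ Γ → y ≢ x
  fresh-≢ n p refl = n (∈-dom p)

  agree-upd : ∀ {Γ x u b σ} → x ∉ dom Γ → Agree Γ (upd x u b σ) σ
  agree-upd {x = x} n = agree λ {y} p → upd-miss x y (fresh-≢ n p)

  -- The declared types cannot see the update: each is closed over a context in which `x` is not
  -- declared.
  env-upd : ∀ {Δ σ Γ x A u b} → SemWf (Γ ▸ x ⦂ A) → Env Δ σ Γ → Δ ⊢ u ∶ sub σ A →
            Env Δ (upd x u b σ) (Γ ▸ x ⦂ A)
  env-upd {Δ} {x = x} {u = u} {b} (ext w d c n) e du P.here =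
    subst₂ (Δ ⊢_∶_) (sym (upd-hit x)) (sym (c (agree-upd {u = u} {b} n))) du
  env-upd {Δ} {x = x} {u = u} {b} (ext w d c n) e du (P.there {x = y} p) =
    subst₂ (Δ ⊢_∶_) (sym (upd-miss x y (fresh-≢ n p))) (sym (∈-closed w p (agree-upd {u = u} {b} n))) (e p)

  env-wk : ∀ {Δ σ Γ U} → Env Δ σ Γ → Env (U ∷ Δ) (ren ↑h ∘ σ) Γ
  env-wk {σ = σ} e {A = A} p = subst (_ ⊢ _ ∶_) (ren-sub ↑h σ A) (weaken {U = _} (e p))

  under : Name → (ℕ → Tm) → Sub → Sub
  under x b σ = upd x (bvar 0) b (ren ↑h ∘ σ)

  env-under : ∀ {Δ σ Γ x A b} → SemWf (Γ ▸ x ⦂ A) → Env Δ σ Γ →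
              Env (sub σ A ∷ Δ) (under x b σ) (Γ ▸ x ⦂ A)
  env-under {Δ} {σ = σ} {A = A} w@(ext _ d _ _) e = env-upd w (env-wk e)
    (subst (sub σ A ∷ Δ ⊢ bvar 0 ∶_) (ren-sub ↑h σ A) (d-var here (weaken (d e))))

  -- t' is the body t opened with x, up to the treatment β of the dangling indices,
  -- on which the openings of the two calculi differ.
  record Opens (β : Sub → ℕ → Tm) (x : Name) (t t' : Tm) : Set where
    constructor opening
    field opened : ∀ σ → sub (under x (β σ) σ) t' ≡ sub (lifts σ) t
  open Opens

  sem-pi : ∀ {Γ x U T T' β s₁ s₂ s₃} → SemWf (Γ ▸ x ⦂ U) → Opens β x T T' → Γ ⊨ U ∶ srt s₁ →
           (Γ ▸ x ⦂ U) ⊨ T' ∶ srt s₂ → Rl s₁ s₂ s₃ → Γ ⊨ pi U T ∶ srt s₃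
  sem-pi w o d e r {Δ} {σ} env =
    d-pi (d env) (subst (_ ⊢_∶ _) (opened o σ) (e (env-under w env))) r

  sem-lam : ∀ {Γ x U T T' t t' β s} → SemWf (Γ ▸ x ⦂ U) → Opens β x T T' → Opens β x t t' →
            Γ ⊨ pi U T ∶ srt s → (Γ ▸ x ⦂ U) ⊨ t' ∶ T' → Γ ⊨ lam U t ∶ pi U T
  sem-lam w o o' d e {Δ} {σ} env with _ , _ , f , _ ← pi-inv (d env) =
    d-lam f (d env) (subst₂ (_ ⊢_∶_) (opened o' σ) (opened o σ) (e (env-under w env)))

  agree-under : ∀ {Γ x U σ τ b b'} → Agree Γ σ τ → Agree (Γ ▸ x ⦂ U) (under x b σ) (under x b' τ)
  agrees (agree-under {x = x} g) {y} p with y ≡ᵇ x | ≡⇒≡ᵇ y x | p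
  ... | true  | _ | _         = refl
  ... | false | f | P.here    = ⊥-elim (f refl)
  ... | false | _ | P.there q = cong (ren ↑h) (agrees g q)

  closed-body : ∀ {Γ x U T T' β σ τ} → Opens β x T T' → Closed (Γ ▸ x ⦂ U) T' → Agree Γ σ τ →
                sub (lifts σ) T ≡ sub (lifts τ) T
  closed-body {σ = σ} {τ} o c g = trans (sym (opened o σ)) (trans (c (agree-under g)) (opened o τ))

  pi-injˡ : ∀ {U U' T T'} → Tm.pi U T ≡ pi U' T' → U ≡ U'
  pi-injˡ refl = refl

  data WfD : List Tm → Set where
    []  : WfD []
    _∷_ : ∀ {Γ U s} → Γ ⊢ U ∶ srt s → WfD Γ → WfD (U ∷ Γ)

  -- Each declared name is sent to its own index; evaluating validity there extracts an actual de
  -- Bruijn derivation in a well-formed context.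
  generic-env : ∀ {Γ} → SemWf Γ → ∃[ Δ ] ∃[ σ ] (WfD Δ × Env Δ σ Γ)
  generic-env ε = [] , atom , [] , λ ()
  generic-env w₀@(ext w d c n) with _ , σ , v , e ← generic-env w =
    _ , under _ bvar σ , d e ∷ v , env-under w₀ e

  Agree∖ : Name → Sub → Sub → Set
  Agree∖ x σ τ = ∀ h → h ≢ nm x → σ h ≡ τ h

  lifts-agree∖ : ∀ {x σ τ} → Agree∖ x σ τ → Agree∖ x (lifts σ) (lifts τ)
  lifts-agree∖ g (nm y)       n = cong (ren ↑h) (g (nm y) n)
  lifts-agree∖ g (bd zero)    n = refl
  lifts-agree∖ g (bd (suc i)) n = cong (ren ↑h) (g (bd i) λ ())

  Avoids : Name → Tm → Set
  Avoids x t = ∀ {σ τ} → Agree∖ x σ τ → sub σ t ≡ sub τ t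

  avoids-fv : ∀ {x} t → x ∉ P.fv t → Avoids x t
  avoids-fv (var y)   n g = g (nm y) λ { refl → n (here refl) }
  avoids-fv (bvar i)  n g = g (bd i) λ ()
  avoids-fv (srt s)   n g = refl
  avoids-fv (pi U T)  n g = cong₂ pi (avoids-fv U (n ∘ ∈-++⁺ˡ) g) (avoids-fv T (n ∘ ∈-++⁺ʳ (P.fv U)) (lifts-agree∖ g))
  avoids-fv (lam U T) n g = cong₂ lam (avoids-fv U (n ∘ ∈-++⁺ˡ) g) (avoids-fv T (n ∘ ∈-++⁺ʳ (P.fv U)) (lifts-agree∖ g))
  avoids-fv (app t u) n g = cong₂ app (avoids-fv t (n ∘ ∈-++⁺ˡ) g) (avoids-fv u (n ∘ ∈-++⁺ʳ (P.fv t)) g)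

  agree∖-• : ∀ {x u v σ τ} → u ≡ v → Agree∖ x σ τ → Agree∖ x (u • σ) (v • τ)
  agree∖-• e g (nm y)       n = g (nm y) n
  agree∖-• e g (bd zero)    n = e
  agree∖-• e g (bd (suc i)) n = g (bd i) λ ()

  avoids-[] : ∀ {x t u} → Avoids x t → Avoids x u → Avoids x (t [ u ])
  avoids-[] {t = t} {u} a b {σ} {τ} g = trans (sub-[] σ t u) (trans (a (agree∖-• (b g) g)) (sym (sub-[] τ t u)))

  -- The typing rules state freshness for `M` and not for `ℬ M`. It carries over because executing
  -- substitutions creates no names.
  avoidsℬ  : ∀ {x} M → x ∉ C.fvT M → Avoids x (ℬ M)
  avoidsℬL : ∀ {x} l → x ∉ C.fvL l → ∀ {σ τ} → Agree∖ x σ τ → map (sub σ) (ℬL l) ≡ map (sub τ) (ℬL l)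

  avoids-apps : ∀ {x} t l → x ∉ C.fvL l → Avoids x t → Avoids x (apps t (ℬL l))
  avoids-apps t l n a {σ} {τ} g =
    trans (sub-apps σ t (ℬL l)) (trans (cong₂ apps (a g) (avoidsℬL l n g)) (sym (sub-apps τ t (ℬL l))))

  avoidsℬ (pi A B)     n g = cong₂ pi (avoidsℬ A (n ∘ ∈-++⁺ˡ) g) (avoidsℬ B (n ∘ ∈-++⁺ʳ (C.fvT A)) (lifts-agree∖ g))
  avoidsℬ (lam A B)    n g = cong₂ lam (avoidsℬ A (n ∘ ∈-++⁺ˡ) g) (avoidsℬ B (n ∘ ∈-++⁺ʳ (C.fvT A)) (lifts-agree∖ g))
  avoidsℬ (srt s)      n g = refl
  avoidsℬ (fvar y l)   n g = avoids-apps (var y) l (n ∘ there) (λ g → g (nm y) λ { refl → n (here refl) }) g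
  avoidsℬ (bvar i l)   n g = avoids-apps (bvar i) l n (λ g → g (bd i) λ ()) g
  avoidsℬ (app M l)    n g = avoids-apps (ℬ M) l (n ∘ ∈-++⁺ʳ (C.fvT M)) (avoidsℬ M (n ∘ ∈-++⁺ˡ)) g
  avoidsℬ (esub P A M) n g = avoids-[] {t = ℬ M}
    (avoidsℬ M (n ∘ ∈-++⁺ʳ (C.fvT P) ∘ ∈-++⁺ʳ (C.fvT A))) (avoidsℬ P (n ∘ ∈-++⁺ˡ)) g
  avoidsℬL nil          n g = refl
  avoidsℬL (cons M l)   n g = cong₂ _∷_ (avoidsℬ M (n ∘ ∈-++⁺ˡ) g) (avoidsℬL l (n ∘ ∈-++⁺ʳ (C.fvT M)) g)
  avoidsℬL (cat l k)    n {σ} {τ} g = trans (map-++ (sub σ) (ℬL l) (ℬL k))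
    (trans (cong₂ _++_ (avoidsℬL l (n ∘ ∈-++⁺ˡ) g) (avoidsℬL k (n ∘ ∈-++⁺ʳ (C.fvL l)) g))
      (sym (map-++ (sub τ) (ℬL l) (ℬL k))))
  avoidsℬL (lsub P A l) n {σ} {τ} g = trans (map-sub-[] σ (ℬL l)) (trans
    (avoidsℬL l (n ∘ ∈-++⁺ʳ (C.fvT P) ∘ ∈-++⁺ʳ (C.fvT A)) (agree∖-• (avoidsℬ P (n ∘ ∈-++⁺ˡ) g) g))
    (sym (map-sub-[] τ (ℬL l))))
    where
    map-sub-[] : ∀ σ us → map (sub σ) (map (_[ ℬ P ]) us) ≡ map (sub (sub σ (ℬ P) • σ)) us
    map-sub-[] σ us = trans (sym (map-∘ us)) (map-cong (λ t → sub-[] σ t (ℬ P)) us)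

  -- Substituting for index 0 lowers the remaining indices, so index `i` must receive what `lifts σ`
  -- gives to `suc i`.
  opens-P : ∀ {x} t → x ∉ P.fv t → Opens (λ σ i → ren ↑h (σ (bd i))) x t (t [ var x ])
  opens-P {x} t n = opening λ σ → trans (sub-[] (under x _ σ) t (var x)) (avoids-fv t n (pt σ))
    where
    pt : ∀ σ → Agree∖ x (under x bvar σ (nm x) • under x _ σ) (lifts σ)
    pt σ (nm y)       ne = upd-miss x y λ { refl → ne refl }
    pt σ (bd zero)    ne = upd-hit x
    pt σ (bd (suc i)) ne = refl

  -- `openT` leaves the remaining indices where they are, so index `i` must receive what `lifts σ`
  -- gives to `i`.
  opens-C : ∀ {x} M → x ∉ C.fvT M → Opens (λ σ i → lifts σ (bd i)) x (ℬ M) (ℬ (C.openT x M))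
  opens-C {x} M n = opening λ σ → trans (cong (sub (under x _ σ)) (trans (cong ℬ (openT-hren x M)) (ℬ-hren (openH x) M)))
    (trans (sub-ren (under x _ σ) (openH x) (ℬ M)) (avoidsℬ M n (pt σ)))
    where
    pt : ∀ σ → Agree∖ x (under x _ σ ∘ openH x) (lifts σ)
    pt σ (nm y)       ne = upd-miss x y λ { refl → ne refl }
    pt σ (bd zero)    ne = upd-hit x
    pt σ (bd (suc i)) ne = refl

  -- Soundness of the PTS rules.

  pts-semwf : ∀ {Γ} → P.Wf Γ → SemWf Γ
  -- Extending an environment relies on the declared types being closed, so context, closedness and
  -- validity are established together.
  pts-sem   : ∀ {Γ t T} → Γ P.⊢ t ∶ T → SemWf Γ × Closed Γ t × Γ ⊨ t ∶ T

  pts-semwf P.wf-ε         = ε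
  pts-semwf (P.wf-ext d n) with w , c , e ← pts-sem d = ext w e c n

  pts-sem (P.t-var w p) = pts-semwf w , (λ g → agrees g p) , λ e → e p
  pts-sem (P.t-sort w a) = pts-semwf w , (λ g → refl) , λ e → d-sort a
  pts-sem (P.t-pi {T = T} d n e r) with w , c , d' ← pts-sem d | w' , c' , e' ← pts-sem e =
    w , (λ g → cong₂ pi (c g) (closed-body (opens-P T n) c' g)) , sem-pi w' (opens-P T n) d' e' r
  pts-sem (P.t-lam {T = T} {t} d n n' e) with w , c , d' ← pts-sem d | w' , c' , e' ← pts-sem e =
    w , (λ g → cong₂ lam (pi-injˡ (c g)) (closed-body (opens-P t n) c' g)) ,
    sem-lam w' (opens-P T n') (opens-P t n) d' e'
  pts-sem (P.t-app {u = u} {T = T} d e) with w , c , d' ← pts-sem d | _ , c' , e' ← pts-sem e =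
    w , (λ g → cong₂ app (c g) (c' g)) ,
    λ {_} {σ} env → subst (_ ⊢ _ ∶_) (sym (sub-[]-comm σ T u)) (app-intro (d' env) (e' env))
  pts-sem (P.t-conv d e c) with w , cl , d' ← pts-sem d | _ , _ , e' ← pts-sem e =
    w , cl , λ {_} {σ} env → d-conv (d' env) (e' env) (sub-conv σ c)

  -- Soundness of the PTSC rules.

  ⟦_⟧ : C.Ctx → P.Ctx
  ⟦ ε ⟧         = ε
  ⟦ Γ ▸ x ⦂ A ⟧ = ⟦ Γ ⟧ ▸ x ⦂ ℬ A

  dom-⟦⟧ : ∀ Γ → dom ⟦ Γ ⟧ ≡ C.dom Γ
  dom-⟦⟧ ε           = refl
  dom-⟦⟧ (Γ ▸ x ⦂ A) = cong (x ∷_) (dom-⟦⟧ Γ)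

  ∈-⟦⟧ : ∀ {Γ x A} → x C.⦂ A ∈ Γ → x P.⦂ ℬ A ∈ ⟦ Γ ⟧
  ∈-⟦⟧ C.here      = P.here
  ∈-⟦⟧ (C.there p) = P.there (∈-⟦⟧ p)

  ∈-⟦⟧⁻ : ∀ {Γ x A} → x P.⦂ A ∈ ⟦ Γ ⟧ → ∃[ B ] x C.⦂ B ∈ Γ
  ∈-⟦⟧⁻ {Γ ▸ x ⦂ A} P.here      = _ , C.here
  ∈-⟦⟧⁻ {Γ ▸ x ⦂ A} (P.there p) with _ , q ← ∈-⟦⟧⁻ p = _ , C.there q

  β*⇒conv : ∀ {t u} → t ⟶β* u → t ↔β* u
  β*⇒conv = gmap (λ t → t) fwd

  ℬ-conv : ∀ {A B} → A C.↔* B → ℬ A ↔β* ℬ B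
  ℬ-conv refl*       = refl*
  ℬ-conv (fwd s ◅ r) = β*⇒conv (soundT s) ◅◅ ℬ-conv r
  ℬ-conv (bwd s ◅ r) = Eq.symmetric _⟶β_ (β*⇒conv (soundT s)) ◅◅ ℬ-conv r

  conv : ∀ {Δ t A B s} σ → Δ ⊢ t ∶ sub σ (ℬ A) → Δ ⊢ sub σ (ℬ B) ∶ srt s → A C.↔* B → Δ ⊢ t ∶ sub σ (ℬ B)
  conv σ d e c = d-conv d e (sub-conv σ (ℬ-conv c))

  -- `Γ'` declares only convertible types, and a conversion must end in a sorted type. The sort
  -- comes from validity of the declaration in the environment for its own prefix, built
  -- recursively.
  env-⊑ : ∀ {Γ Γ' Δ σ} → SemWf ⟦ Γ ⟧ → Γ C.⊑ Γ' → Env Δ σ ⟦ Γ' ⟧ → Env Δ σ ⟦ Γ ⟧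
  env-⊑ {Γ ▸ y ⦂ B} {σ = σ} (ext w d c n) i e P.here with _ , p , q ← i C.here =
    conv σ (e (∈-⟦⟧ p)) (d (env-⊑ w (i ∘ C.there) e)) (Eq.symmetric _ q)
  env-⊑ {Γ ▸ y ⦂ B} (ext w d c n) i e (P.there p) = env-⊑ w (i ∘ C.there) e p

  -- The images of the dangling indices make sub-inst hold without local closure of M.
  inst : Name → C.Tm → Sub → Sub
  inst x P σ = upd x (sub σ (ℬ P)) (λ i → (sub σ (ℬ P) • σ) (bd i)) σ

  inst-≗ : ∀ x P σ h → (sub σ (ℬ P) • σ) (closeH x h) ≡ inst x P σ h
  inst-≗ x P σ (bd i) = refl
  inst-≗ x P σ (nm y) with y ≡ᵇ x
  ... | true  = refl
  ... | false = refl

  sub-inst : ∀ σ P A x M → sub σ (ℬ (C.esubN P A x M)) ≡ sub (inst x P σ) (ℬ M)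
  sub-inst σ P A x M = trans (cong (λ t → sub σ (t [ ℬ P ])) (trans (cong ℬ (closeT-hren x M)) (ℬ-hren (closeH x) M)))
    (trans (sub-[] σ (ren (closeH x) (ℬ M)) (ℬ P)) (trans (sub-ren (sub σ (ℬ P) • σ) (closeH x) (ℬ M))
      (sub-cong (inst-≗ x P σ) (ℬ M))))

  sub-instL : ∀ σ P A x l → map (sub σ) (ℬL (C.lsubN P A x l)) ≡ map (sub (inst x P σ)) (ℬL l)
  sub-instL σ P A x l = trans (sym (map-∘ (ℬL (C.closeL x l)))) (trans
    (cong (map _) (trans (cong ℬL (closeL-hren x l)) (ℬL-hren (closeH x) l))) (trans (sym (map-∘ (ℬL l)))
    (map-cong (λ t → trans (sub-[] σ (ren (closeH x) t) (ℬ P)) (trans (sub-ren (sub σ (ℬ P) • σ) (closeH x) t)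
      (sub-cong (inst-≗ x P σ) t))) (ℬL l))))

  sub-substTy : ∀ σ P A x B → sub σ (ℬ (C.substTy P A x B)) ≡ sub (inst x P σ) (ℬ B)
  sub-substTy σ P A x (srt s)        = refl
  sub-substTy σ P A x B@(pi _ _)     = sub-inst σ P A x B
  sub-substTy σ P A x B@(lam _ _)    = sub-inst σ P A x B
  sub-substTy σ P A x B@(fvar _ _)   = sub-inst σ P A x B
  sub-substTy σ P A x B@(bvar _ _)   = sub-inst σ P A x B
  sub-substTy σ P A x B@(app _ _)    = sub-inst σ P A x B
  sub-substTy σ P A x B@(esub _ _ _) = sub-inst σ P A x B

  ⧺-∈ˡ : ∀ {Γ y B P A x} Δ → y C.⦂ B ∈ Γ → y C.⦂ B ∈ (Γ C.⧺ C.substCtx P A x Δ)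
  ⧺-∈ˡ ε           p = p
  ⧺-∈ˡ (Δ ▸ z ⦂ D) p = C.there (⧺-∈ˡ Δ p)

  split-∈ : ∀ {Γ x A P y B} Δ → y P.⦂ B ∈ ⟦ (Γ ▸ x ⦂ A) C.⧺ Δ ⟧ →
            y ≡ x ⊎ ∃[ D ] y C.⦂ D ∈ (Γ C.⧺ C.substCtx P A x Δ)
  split-∈ ε           P.here      = inj₁ refl
  split-∈ ε           (P.there p) = inj₂ (∈-⟦⟧⁻ p)
  split-∈ (Δ ▸ z ⦂ D) P.here      = inj₂ (_ , C.here)
  split-∈ (Δ ▸ z ⦂ D) (P.there p) with split-∈ Δ p
  ... | inj₁ e       = inj₁ e
  ... | inj₂ (_ , q) = inj₂ (_ , C.there q)

  mid-∈ : ∀ {Γ x A} Δ → x P.⦂ ℬ A ∈ ⟦ (Γ ▸ x ⦂ A) C.⧺ Δ ⟧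
  mid-∈ ε           = P.here
  mid-∈ (Δ ▸ z ⦂ D) = P.there (mid-∈ Δ)

  -- The key to both substitution rules: an environment for `Δ'` becomes one for the context of the
  -- body by evaluating `P` at `x`. Declarations after `x` are met in `Δ'` only up to conversion, as
  -- in `env-⊑`.
  env-inst : ∀ {Γ P A x Δ' Θ σ} Δ → SemWf ⟦ (Γ ▸ x ⦂ A) C.⧺ Δ ⟧ → (Γ C.⧺ C.substCtx P A x Δ) C.⊑ Δ' →
             ⟦ Γ ⟧ ⊨ ℬ P ∶ ℬ A → Env Θ σ ⟦ Δ' ⟧ → Env Θ (inst x P σ) ⟦ (Γ ▸ x ⦂ A) C.⧺ Δ ⟧
  env-inst ε w₀@(ext w d c n) i dP e p = env-upd w₀ env (dP env) p
    where env = env-⊑ w i e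
  env-inst {P = P} {A} {x} {Θ = Θ} {σ} (Δ ▸ y ⦂ B) (ext w d c n) i dP e P.here with _ , p , q ← i C.here =
    subst₂ (Θ ⊢_∶_) (sym (upd-miss x y λ { refl → n (∈-dom (mid-∈ Δ)) })) (sub-inst σ P A x B)
      (conv σ (e (∈-⟦⟧ p)) (subst (Θ ⊢_∶ _) (sym (sub-inst σ P A x B)) (d (env-inst Δ w (i ∘ C.there) dP e)))
        (Eq.symmetric _ q))
  env-inst (Δ ▸ y ⦂ B) (ext w d c n) i dP e (P.there p) = env-inst Δ w (i ∘ C.there) dP e p

  agree-inst : ∀ {Γ P A x Δ' σ τ} Δ → (Γ C.⧺ C.substCtx P A x Δ) C.⊑ Δ' → Closed ⟦ Γ ⟧ (ℬ P) →
               Agree ⟦ Δ' ⟧ σ τ → Agree ⟦ (Γ ▸ x ⦂ A) C.⧺ Δ ⟧ (inst x P σ) (inst x P τ)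
  agrees (agree-inst {Γ} {P} {A} {x} {Δ'} {σ} {τ} Δ i cP g) {y} p with y ≡ᵇ x | ≡⇒≡ᵇ y x
  ... | true  | _ = cP (agree λ q → let _ , q' = ∈-⟦⟧⁻ q ; _ , q'' , _ = i (⧺-∈ˡ Δ q') in agrees g (∈-⟦⟧ q''))
  ... | false | f with split-∈ {P = P} Δ p
  ...   | inj₁ e       = ⊥-elim (f e)
  ...   | inj₂ (_ , q) = let _ , q' , _ = i q in agrees g (∈-⟦⟧ q')

  ClosedL : P.Ctx → C.Ls → Set
  ClosedL Γ l = ∀ {σ τ} → Agree Γ σ τ → map (sub σ) (ℬL l) ≡ map (sub τ) (ℬL l)

  -- A list acts as a map from heads of type `A` to spines of type `B`. The sort of `A` is recorded
  -- so that `l-convL` can convert a head back to `A`.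
  SemL : P.Ctx → C.Tm → C.Ls → C.Tm → Set
  SemL Γ A l B = ∀ {Δ σ} → Env Δ σ Γ → (∃[ s ] (Δ ⊢ sub σ (ℬ A) ∶ srt s)) ×
                 (∀ {h} → Δ ⊢ h ∶ sub σ (ℬ A) → Δ ⊢ apps h (map (sub σ) (ℬL l)) ∶ sub σ (ℬ B))

  closed-apps : ∀ {Γ h} l → Closed Γ h → ClosedL Γ l → Closed Γ (apps h (ℬL l))
  closed-apps {h = h} l c cl {σ} {τ} g =
    trans (sub-apps σ h (ℬL l)) (trans (cong₂ apps (c g) (cl g)) (sym (sub-apps τ h (ℬL l))))

  ptsc-semwf : ∀ {Γ} → C.Wf Γ → SemWf ⟦ Γ ⟧
  ptsc-sem   : ∀ {Γ M A} → Γ C.⊢ M ∶ A → SemWf ⟦ Γ ⟧ × Closed ⟦ Γ ⟧ (ℬ M) × ⟦ Γ ⟧ ⊨ ℬ M ∶ ℬ A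
  ptsc-semL  : ∀ {Γ A l B} → Γ C.∣ A ⊢ₗ l ∶ B → SemWf ⟦ Γ ⟧ × ClosedL ⟦ Γ ⟧ l × Closed ⟦ Γ ⟧ (ℬ A) × SemL ⟦ Γ ⟧ A l B

  ptsc-semwf C.wf-ε = ε
  ptsc-semwf (C.wf-ext {Γ} {x} d n) with w , c , e ← ptsc-sem d = ext w e c (subst (x ∉_) (sym (dom-⟦⟧ Γ)) n)

  ptsc-sem (C.t-sort w a) = ptsc-semwf w , (λ g → refl) , λ e → d-sort a
  ptsc-sem (C.t-pi {B = B} d n e r) with w , c , d' ← ptsc-sem d | w' , c' , e' ← ptsc-sem e =
    w , (λ g → cong₂ pi (c g) (closed-body (opens-C B n) c' g)) , sem-pi w' (opens-C B n) d' e' r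
  ptsc-sem (C.t-lam {B = B} {M} d n n' e) with w , c , d' ← ptsc-sem d | w' , c' , e' ← ptsc-sem e =
    w , (λ g → cong₂ lam (pi-injˡ (c g)) (closed-body (opens-C M n) c' g)) ,
    sem-lam w' (opens-C B n') (opens-C M n) d' e'
  ptsc-sem (C.t-var {l = l} {x} d p) with w , c , _ , d' ← ptsc-semL d =
    w , closed-apps l (λ g → agrees g (∈-⟦⟧ p)) c ,
    λ {_} {σ} e → subst (_ ⊢_∶ _) (sym (sub-apps σ (var x) (ℬL l))) (proj₂ (d' e) (e (∈-⟦⟧ p)))
  ptsc-sem (C.t-conv d e c) with w , cl , d' ← ptsc-sem d | _ , _ , e' ← ptsc-sem e =
    w , cl , λ {_} {σ} env → conv σ (d' env) (e' env) c
  ptsc-sem (C.t-app {M = M} {l = l} d e) with w , c , d' ← ptsc-sem d | _ , c' , _ , e' ← ptsc-semL e =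
    w , closed-apps l c c' ,
    λ {_} {σ} env → subst (_ ⊢_∶ _) (sym (sub-apps σ (ℬ M) (ℬL l))) (proj₂ (e' env) (d' env))
  ptsc-sem (C.t-esub {Δ = Δ} {P = P} {A} {x} {M} {B} d e i w)
    with _ , c , d' ← ptsc-sem d | w' , c' , e' ← ptsc-sem e =
    ptsc-semwf w ,
    (λ {σ} {τ} g → trans (sub-inst σ P A x M) (trans (c' (agree-inst {P = P} Δ i c g)) (sym (sub-inst τ P A x M)))) ,
    λ {Θ} {σ} env → subst₂ (Θ ⊢_∶_) (sym (sub-inst σ P A x M)) (sym (sub-substTy σ P A x B))
                      (e' (env-inst Δ w' i d' env))

  ptsc-semL (C.l-nil d) with w , c , d' ← ptsc-sem d = w , (λ g → refl) , c , λ env → (_ , d' env) , λ h → h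
  ptsc-semL (C.l-cons {B = B} {M} {l} d e f)
    with w , cΠ , d' ← ptsc-sem d | _ , c , e' ← ptsc-sem e | _ , c' , _ , f' ← ptsc-semL f =
    w , (λ g → cong₂ _∷_ (c g) (c' g)) , cΠ ,
    λ {_} {σ} env → (_ , d' env) ,
      -- The type of `h` applied to `M` is the image of `esub M A B`, the type at which the rule
      -- places the tail.
      λ h → proj₂ (f' env) (subst (_ ⊢ _ ∶_) (sym (sub-[]-comm σ (ℬ B) (ℬ M))) (app-intro h (e' env)))
  ptsc-semL (C.l-convR d e c) with w , cl , cA , d' ← ptsc-semL d | _ , _ , e' ← ptsc-sem e =
    w , cl , cA , λ {_} {σ} env → proj₁ (d' env) , λ h → conv σ (proj₂ (d' env) h) (e' env) c
  ptsc-semL (C.l-convL d e c) with w , cl , _ , d' ← ptsc-semL d | _ , cB , e' ← ptsc-sem e =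
    w , cl , cB , λ {_} {σ} env → (_ , e' env) ,
      λ h → proj₂ (d' env) (conv σ h (proj₂ (proj₁ (d' env))) (Eq.symmetric _ c))
  ptsc-semL (C.l-cat {l' = l} {l = k} d e) with w , c , cC , d' ← ptsc-semL d | _ , c' , _ , e' ← ptsc-semL e =
    w , (λ {σ} {τ} g → trans (map-++ (sub σ) (ℬL l) (ℬL k)) (trans (cong₂ _++_ (c g) (c' g)) (sym (map-++ (sub τ) (ℬL l) (ℬL k))))) ,
    cC , λ {Θ} {σ} env → proj₁ (d' env) ,
      λ {h} dh → subst (Θ ⊢_∶ _)
        (trans (apps-++ h (map (sub σ) (ℬL l)) (map (sub σ) (ℬL k))) (cong (apps h) (sym (map-++ (sub σ) (ℬL l) (ℬL k)))))
        (proj₂ (e' env) (proj₂ (d' env) dh))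
  ptsc-semL (C.l-sub {Δ = Δ} {P = P} {A} {x} {B} {l} {D} d e i w)
    with _ , c , d' ← ptsc-sem d | w' , c' , cB , e' ← ptsc-semL e =
    ptsc-semwf w ,
    (λ {σ} {τ} g → trans (sub-instL σ P A x l) (trans (c' (agree-inst {P = P} Δ i c g)) (sym (sub-instL τ P A x l)))) ,
    (λ {σ} {τ} g → trans (sub-inst σ P A x B) (trans (cB (agree-inst {P = P} Δ i c g)) (sym (sub-inst τ P A x B)))) ,
    λ {Θ} {σ} env → let (s , dB) , f = e' (env-inst Δ w' i d' env) in
      (s , subst (Θ ⊢_∶ srt s) (sym (sub-inst σ P A x B)) dB) ,
      λ {h} dh → subst₂ (Θ ⊢_∶_) (cong (apps h) (sym (sub-instL σ P A x l))) (sym (sub-inst σ P A x D))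
        (f (subst (Θ ⊢ h ∶_) (sub-inst σ P A x B) dh))

-- Fresh names.

∈⇒≤sum : ∀ {x xs} → x ∈ xs → x ≤ sum xs
∈⇒≤sum {xs = y ∷ xs} (here refl) = m≤m+n y (sum xs)
∈⇒≤sum {xs = y ∷ xs} (there p)   = ≤-trans (∈⇒≤sum p) (m≤n+m (sum xs) y)

fresh : (xs : List Name) → ∃[ x ] x ∉ xs
fresh xs = suc (sum xs) , λ p → n≮n (sum xs) (∈⇒≤sum p)

-- Encoding PTS terms in the PTSC and simulating β.

module Equivalence (S : Set) (Ax : S → S → Set) (Rl : S → S → S → Set) where
  open Substitutions S Ax Rl
  open HeadRenaming S Ax Rl
  open Translation S Ax Rl
  open Normalisation S Ax Rl
  open DeBruijn S Ax Rl
  open Interpretation S Ax Rl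
  open P using (Tm; var; bvar; srt; pi; lam; app; _⟶β_; _[_]; _↔β*_; ε; _▸_⦂_; dom)
  open C using (esub; nil; cons; fvar; bvar; srt; pi; lam; app; ε; _▸_⦂_; _⟶t_)

  𝒜 : Tm → C.Tm
  𝒜 (var x)   = fvar x nil
  𝒜 (bvar i)  = bvar i nil
  𝒜 (srt s)   = srt s
  𝒜 (pi U T)  = pi (𝒜 U) (𝒜 T)
  𝒜 (lam U t) = lam (𝒜 U) (𝒜 t)
  𝒜 (app t u) = app (𝒜 t) (cons (𝒜 u) nil)

  𝒜-atom : ∀ h → 𝒜 (atom h) ≡ mk h nil
  𝒜-atom (nm x) = refl
  𝒜-atom (bd i) = refl

  𝒜-ren : ∀ f t → 𝒜 (ren f t) ≡ hrenT f (𝒜 t)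
  𝒜-ren f (var x)   = 𝒜-atom (f (nm x))
  𝒜-ren f (bvar i)  = 𝒜-atom (f (bd i))
  𝒜-ren f (srt s)   = refl
  𝒜-ren f (pi U T)  = cong₂ pi (𝒜-ren f U) (𝒜-ren (liftr f) T)
  𝒜-ren f (lam U T) = cong₂ lam (𝒜-ren f U) (𝒜-ren (liftr f) T)
  𝒜-ren f (app t u) = cong₂ (λ M N → app M (cons N nil)) (𝒜-ren f t) (𝒜-ren f u)

  infix 4 _⟶t*_
  _⟶t*_ : C.Tm → C.Tm → Set
  _⟶t*_ = Star _⟶t_

  𝒜-under : ∀ f u G t → esub (C.shiftT 0 (𝒜 u)) G (C.swapT 0 (𝒜 (ren (liftr f) t))) ≡
            esub (𝒜 (P.shift 0 u)) G (𝒜 (ren (swapH ∘ liftr f) t))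
  𝒜-under f u G t = cong₂ (λ N → esub N G)
    (trans (shiftT-hren (𝒜 u)) (trans (sym (𝒜-ren ↑h u)) (cong 𝒜 (sym (shift-as-ren 0 u)))))
    (trans (swapT-hren (𝒜 (ren (liftr f) t))) (trans (sym (𝒜-ren swapH (ren (liftr f) t))) (cong 𝒜 (ren-ren swapH (liftr f) t))))

  C-pi* : ∀ {A A' B B'} → A ⟶t* A' → B ⟶t* B' → pi A B ⟶t* pi A' B'
  C-pi* r q = gmap (λ A → pi A _) C.c-pi₁ r ◅◅ gmap (pi _) C.c-pi₂ q

  C-lam* : ∀ {A A' B B'} → A ⟶t* A' → B ⟶t* B' → lam A B ⟶t* lam A' B'
  C-lam* r q = gmap (λ A → lam A _) C.c-lam₁ r ◅◅ gmap (lam _) C.c-lam₂ q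

  C-app* : ∀ {M M' N N'} → M ⟶t* M' → N ⟶t* N' → app M (cons N nil) ⟶t* app M' (cons N' nil)
  C-app* r q = gmap (λ M → app M _) C.c-app₁ r ◅◅ gmap (λ N → app _ (cons N nil)) (C.c-app₂ ∘ C.c-cons₁) q

  -- Stated for a renamed body because pushing a substitution under a binder renames it.
  esub-ren* : ∀ f u G t → esub (𝒜 u) G (𝒜 (ren f t)) ⟶t* 𝒜 (ren f t [ u ])
  esub-body* : ∀ f u G t → esub (C.shiftT 0 (𝒜 u)) G (C.swapT 0 (𝒜 (ren (liftr f) t))) ⟶t*
               𝒜 (P.subst 1 (P.shift 0 u) (ren (liftr f) t))
  esub-atom* : ∀ u G h → esub (𝒜 u) G (𝒜 (atom h)) ⟶t* 𝒜 (atom h [ u ])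

  esub-atom* u G (nm x)       = C.r-s-fvar ◅ C.c-fvar C.r-s-nil ◅ refl*
  esub-atom* u G (bd zero)    = C.r-s-hit ◅ C.c-app₂ C.r-s-nil ◅ C.r-nil ◅ refl*
  esub-atom* u G (bd (suc i)) = C.r-s-bvar ◅ C.c-bvar C.r-s-nil ◅ refl*

  esub-body* f u G t = subst₂ _⟶t*_ (sym (𝒜-under f u G t))
    (cong 𝒜 (trans (cong (_[ P.shift 0 u ]) (sym (ren-ren swapH (liftr f) t))) (swap-[] u (ren (liftr f) t))))
    (esub-ren* (swapH ∘ liftr f) (P.shift 0 u) G t)

  esub-ren* f u G (var x)   = esub-atom* u G (f (nm x))
  esub-ren* f u G (bvar i)  = esub-atom* u G (f (bd i))
  esub-ren* f u G (srt s)   = C.r-s-srt ◅ refl*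
  esub-ren* f u G (pi U T)  = C.r-s-pi ◅
    C-pi* (esub-ren* f u G U) (esub-body* f u (C.shiftT 0 G) T)
  esub-ren* f u G (lam U T) = C.r-s-lam ◅
    C-lam* (esub-ren* f u G U) (esub-body* f u (C.shiftT 0 G) T)
  esub-ren* f u G (app t v) = C.r-s-app ◅ C.c-app₂ C.r-s-cons ◅ C.c-app₂ (C.c-cons₂ C.r-s-nil) ◅
    C-app* (esub-ren* f u G t) (esub-ren* f u G v)

  ren-id : ∀ t → ren (λ h → h) t ≡ t
  ren-id t = trans (ren-as-sub (λ h → h) t) (sub-id t)

  esub* : ∀ u G t → esub (𝒜 u) G (𝒜 t) ⟶t* 𝒜 (t [ u ])
  esub* u G t = subst (λ t → esub (𝒜 u) G (𝒜 t) ⟶t* 𝒜 (t [ u ])) (ren-id t) (esub-ren* (λ h → h) u G t)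

  _⟶t⁺_ : C.Tm → C.Tm → Set
  M ⟶t⁺ N = ∃[ K ] (M ⟶t K × K ⟶t* N)

  gmap⁺ : ∀ (f : C.Tm → C.Tm) → (∀ {M N} → M ⟶t N → f M ⟶t f N) → ∀ {M N} → M ⟶t⁺ N → f M ⟶t⁺ f N
  gmap⁺ f c (_ , s , r) = _ , c s , gmap f c r

  𝒜-β : ∀ {t t'} → t ⟶β t' → 𝒜 t ⟶t⁺ 𝒜 t'
  𝒜-β (P.beta {V} {t} {u}) = _ , C.r-beta , C.r-nil ◅ esub* u (𝒜 V) t
  𝒜-β (P.c-pi₁ s)  = gmap⁺ _ C.c-pi₁ (𝒜-β s)
  𝒜-β (P.c-pi₂ s)  = gmap⁺ _ C.c-pi₂ (𝒜-β s)
  𝒜-β (P.c-lam₁ s) = gmap⁺ _ C.c-lam₁ (𝒜-β s)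
  𝒜-β (P.c-lam₂ s) = gmap⁺ _ C.c-lam₂ (𝒜-β s)
  𝒜-β (P.c-app₁ s) = gmap⁺ _ C.c-app₁ (𝒜-β s)
  𝒜-β (P.c-app₂ s) = gmap⁺ (λ M → app _ (cons M nil)) (C.c-app₂ ∘ C.c-cons₁) (𝒜-β s)

  𝒜-conv : ∀ {t u} → t ↔β* u → 𝒜 t C.↔* 𝒜 u
  𝒜-conv refl* = refl*
  𝒜-conv (fwd s ◅ r) with _ , s' , r' ← 𝒜-β s = (fwd s' ◅ gmap (λ M → M) fwd r') ◅◅ 𝒜-conv r
  𝒜-conv (bwd s ◅ r) with _ , s' , r' ← 𝒜-β s = Eq.symmetric _ (fwd s' ◅ gmap (λ M → M) fwd r') ◅◅ 𝒜-conv r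

  -- Accessibility decreases by one step at a time and may land between two encodings, so the
  -- induction is over every `M` that reduces to the encoding.
  𝒜-SN⁻ : ∀ {t} → C.SN (𝒜 t) → P.SN t
  𝒜-SN⁻ a = go a refl*
    where
    go : ∀ {M t} → C.SN M → M ⟶t* 𝒜 t → P.SN t
    go⁺ : ∀ {M t} → C.SN M → M ⟶t⁺ 𝒜 t → P.SN t
    go a q = acc λ s → go⁺ a (plus q (𝒜-β s))
      where
      plus : ∀ {M N K} → M ⟶t* N → N ⟶t⁺ K → M ⟶t⁺ K
      plus refl*   p           = p
      plus (s ◅ q) (_ , s' , r) = _ , s , q ◅◅ s' ◅ r
    go⁺ (acc r) (_ , s , q) = go (r s) q

  sub-SN⁻ : ∀ σ {t} → P.SN (sub σ t) → P.SN t
  sub-SN⁻ σ (acc r) = acc λ s → sub-SN⁻ σ (r (sub-β σ s))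

  -- Turning de Bruijn derivations into named ones.

  named : (ℕ → Name) → Sub
  named ν (nm x) = var x
  named ν (bd i) = var (ν i)

  _◂_ : Name → (ℕ → Name) → ℕ → Name
  (x ◂ ν) zero    = x
  (x ◂ ν) (suc i) = ν i

  data Naming : List Tm → (ℕ → Name) → P.Ctx → Set where
    []  : ∀ {ν} → Naming [] ν ε
    _∷_ : ∀ {Γ ν Γ' x U} → x ∉ dom Γ' → Naming Γ ν Γ' → Naming (U ∷ Γ) (x ◂ ν) (Γ' ▸ x ⦂ sub (named ν) U)

  named-↑ : ∀ x ν t → sub (named (x ◂ ν)) (ren ↑h t) ≡ sub (named ν) t
  named-↑ x ν t = trans (sub-ren (named (x ◂ ν)) ↑h t) (sub-cong (λ { (nm y) → refl ; (bd i) → refl }) t)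

  named-lookup : ∀ {Γ ν Γ' i T} → Naming Γ ν Γ' → Lookup Γ i T → ν i P.⦂ sub (named ν) T ∈ Γ'
  named-lookup (_∷_ {ν = ν} {x = x} {U} n v) here =
    subst (λ A → x P.⦂ A ∈ (_ ▸ x ⦂ sub (named ν) U)) (sym (named-↑ x ν U)) P.here
  named-lookup (_∷_ {ν = ν} {x = x} n v) (there {T = T} l) =
    subst (_ P.⦂_∈ _) (sym (named-↑ x ν T)) (P.there (named-lookup v l))

  body : (ℕ → Name) → Tm → Tm
  body ν = sub (lifts (named ν))

  body-[] : ∀ ν x t → body ν t [ var x ] ≡ sub (named (x ◂ ν)) t
  body-[] ν x t = trans (lifts-[] (named ν) t (var x))
    (sub-cong (λ { (nm y) → refl ; (bd zero) → refl ; (bd (suc i)) → refl }) t)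

  DB⇒PTS : ∀ {Γ ν Γ' t T} → Γ ⊢ t ∶ T → Naming Γ ν Γ' → P.Wf Γ' → Γ' P.⊢ sub (named ν) t ∶ sub (named ν) T
  DB⇒PTS (d-var l d) v w = P.t-var w (named-lookup v l)
  DB⇒PTS (d-sort a) v w = P.t-sort w a
  DB⇒PTS {ν = ν} {Γ'} (d-pi {T = T} d e r) v w with x , n ← fresh (P.fv (body ν T) ++ dom Γ') =
    P.t-pi d' (n ∘ ∈-++⁺ˡ)
      (subst (_ P.⊢_∶ _) (sym (body-[] ν x T)) (DB⇒PTS e (n' ∷ v) (P.wf-ext d' n'))) r
    where
    d' = DB⇒PTS d v w
    n' = n ∘ ∈-++⁺ʳ (P.fv (body ν T))
  DB⇒PTS {ν = ν} {Γ'} (d-lam {T = T} {t} d e f) v w with x , n ← fresh (P.fv (body ν t) ++ P.fv (body ν T) ++ dom Γ') =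
    P.t-lam (DB⇒PTS e v w) (n ∘ ∈-++⁺ˡ) (n ∘ ∈-++⁺ʳ (P.fv (body ν t)) ∘ ∈-++⁺ˡ)
      (subst₂ (_ P.⊢_∶_) (sym (body-[] ν x t)) (sym (body-[] ν x T)) (DB⇒PTS f (n' ∷ v) (P.wf-ext (DB⇒PTS d v w) n')))
    where n' = n ∘ ∈-++⁺ʳ (P.fv (body ν t)) ∘ ∈-++⁺ʳ (P.fv (body ν T))
  DB⇒PTS {ν = ν} (d-app {u = u} {T = T} d e f g h k) v w =
    subst (_ P.⊢ _ ∶_) (sym (sub-[]-comm (named ν) T u)) (P.t-app (DB⇒PTS d v w) (DB⇒PTS e v w))
  DB⇒PTS {ν = ν} (d-conv d e c) v w = P.t-conv (DB⇒PTS d v w) (DB⇒PTS e v w) (sub-conv (named ν) c)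

  name-ctx : ∀ {Γ} → WfD Γ → ∃[ ν ] ∃[ Γ' ] (Naming Γ ν Γ' × P.Wf Γ')
  name-ctx []      = (λ i → i) , ε , [] , P.wf-ε
  name-ctx (d ∷ w) with ν , Γ' , v , w' ← name-ctx w with x , n ← fresh (dom Γ') =
    x ◂ ν , _ , n ∷ v , P.wf-ext (DB⇒PTS d v w') n

  𝒜ᶜ : P.Ctx → C.Ctx
  𝒜ᶜ ε           = ε
  𝒜ᶜ (Γ ▸ x ⦂ A) = 𝒜ᶜ Γ ▸ x ⦂ 𝒜 A

  dom-𝒜ᶜ : ∀ Γ → C.dom (𝒜ᶜ Γ) ≡ dom Γ
  dom-𝒜ᶜ ε           = refl
  dom-𝒜ᶜ (Γ ▸ x ⦂ A) = cong (x ∷_) (dom-𝒜ᶜ Γ)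

  ∈-𝒜ᶜ : ∀ {Γ x A} → x P.⦂ A ∈ Γ → x C.⦂ 𝒜 A ∈ 𝒜ᶜ Γ
  ∈-𝒜ᶜ P.here      = C.here
  ∈-𝒜ᶜ (P.there p) = C.there (∈-𝒜ᶜ p)

  openT-body : ∀ ν x t → C.openT x (𝒜 (body ν t)) ≡ 𝒜 (sub (named (x ◂ ν)) t)
  openT-body ν x t = trans (openT-hren x (𝒜 (body ν t))) (trans (sym (𝒜-ren (openH x) (body ν t)))
    (cong 𝒜 (trans (ren-sub (openH x) (lifts (named ν)) t)
      (sub-cong (λ { (nm y) → refl ; (bd zero) → refl ; (bd (suc i)) → refl }) t))))

  -- `t-esub` only types closings of named bodies; presenting a body as the closing of its opening
  -- makes the rule applicable to it.
  close-open : ∀ x t → x ∉ P.fv t → C.closeT x (C.openT x (𝒜 t)) ≡ 𝒜 t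
  close-open x t n = begin
    C.closeT x (C.openT x (𝒜 t))         ≡⟨ closeT-hren x (C.openT x (𝒜 t)) ⟩
    hrenT (closeH x) (C.openT x (𝒜 t))   ≡⟨ cong (hrenT (closeH x)) (trans (openT-hren x (𝒜 t)) (sym (𝒜-ren (openH x) t))) ⟩
    hrenT (closeH x) (𝒜 (ren (openH x) t)) ≡⟨ 𝒜-ren (closeH x) (ren (openH x) t) ⟨
    𝒜 (ren (closeH x) (ren (openH x) t)) ≡⟨ cong 𝒜 (ren-ren (closeH x) (openH x) t) ⟩
    𝒜 (ren (closeH x ∘ openH x) t)       ≡⟨ cong 𝒜 (ren-as-sub (closeH x ∘ openH x) t) ⟩
    𝒜 (sub (atom ∘ closeH x ∘ openH x) t) ≡⟨ cong 𝒜 (avoids-fv t n pt) ⟩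
    𝒜 (sub atom t)                       ≡⟨ cong 𝒜 (sub-id t) ⟩
    𝒜 t                                  ∎
    where
    open ≡-Reasoning
    pt : Agree∖ x (atom ∘ closeH x ∘ openH x) atom
    pt (nm y)       ne = cong atom (upd-miss x y λ { refl → ne refl })
    pt (bd zero)    ne = cong atom (upd-hit x)
    pt (bd (suc i)) ne = refl

  𝒜-wf-ext : ∀ {Γ x A s} → 𝒜ᶜ Γ C.⊢ 𝒜 A ∶ srt s → x ∉ dom Γ → C.Wf (𝒜ᶜ (Γ ▸ x ⦂ A))
  𝒜-wf-ext {Γ} {x} d n = C.wf-ext d (subst (x ∉_) (sym (dom-𝒜ᶜ Γ)) n)

  DB⇒PTSC : ∀ {Γ ν Γ' t T} → Γ ⊢ t ∶ T → Naming Γ ν Γ' → C.Wf (𝒜ᶜ Γ') →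
            𝒜ᶜ Γ' C.⊢ 𝒜 (sub (named ν) t) ∶ 𝒜 (sub (named ν) T)
  DB⇒PTSC (d-var l d) v w = C.t-var (C.l-nil (DB⇒PTSC d v w)) (∈-𝒜ᶜ (named-lookup v l))
  DB⇒PTSC (d-sort a) v w = C.t-sort w a
  DB⇒PTSC {ν = ν} {Γ'} (d-pi {T = T} d e r) v w with x , n ← fresh (C.fvT (𝒜 (body ν T)) ++ dom Γ') =
    C.t-pi d' (n ∘ ∈-++⁺ˡ)
      (subst (_ C.⊢_∶ srt _) (sym (openT-body ν x T)) (DB⇒PTSC e (n' ∷ v) (𝒜-wf-ext d' n'))) r
    where
    d' = DB⇒PTSC d v w
    n' = n ∘ ∈-++⁺ʳ (C.fvT (𝒜 (body ν T)))
  DB⇒PTSC {ν = ν} {Γ'} (d-lam {T = T} {t} d e f) v w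
    with x , n ← fresh (C.fvT (𝒜 (body ν t)) ++ C.fvT (𝒜 (body ν T)) ++ dom Γ') =
    C.t-lam (DB⇒PTSC e v w) (n ∘ ∈-++⁺ˡ) (n ∘ ∈-++⁺ʳ (C.fvT (𝒜 (body ν t))) ∘ ∈-++⁺ˡ)
      (subst₂ (_ C.⊢_∶_) (sym (openT-body ν x t)) (sym (openT-body ν x T))
        (DB⇒PTSC f (n' ∷ v) (𝒜-wf-ext (DB⇒PTSC d v w) n')))
    where n' = n ∘ ∈-++⁺ʳ (C.fvT (𝒜 (body ν t))) ∘ ∈-++⁺ʳ (C.fvT (𝒜 (body ν T)))
  DB⇒PTSC {ν = ν} {Γ'} (d-app {t} {u} {U} {T} {s₂ = s₂} d e f g h k) v w with x , n ← fresh (P.fv (body ν T) ++ dom Γ') =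
    -- `l-cons` types the tail at an explicit substitution, while the result is the executed one. So
    -- `nil` is typed at the executed type and converted on the left.
    C.t-app (DB⇒PTSC d v w) (C.l-cons (DB⇒PTSC f v w) (DB⇒PTSC e v w) (C.l-convL (C.l-nil (DB⇒PTSC k v w)) T[u] conv-T[u]))
    where
    θ = named ν
    n' = n ∘ ∈-++⁺ʳ (P.fv (body ν T))
    T[u] : 𝒜ᶜ Γ' C.⊢ esub (𝒜 (sub θ u)) (𝒜 (sub θ U)) (𝒜 (body ν T)) ∶ srt s₂
    T[u] = subst (λ M → 𝒜ᶜ Γ' C.⊢ esub (𝒜 (sub θ u)) (𝒜 (sub θ U)) M ∶ srt s₂)
      (trans (cong (C.closeT x) (sym (openT-body ν x T))) (close-open x (body ν T) (n ∘ ∈-++⁺ˡ)))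
      -- With `Δ` empty the inclusion is reflexive, and `substTy` leaves the sort `s₂` in place.
      (C.t-esub {Δ = ε} (DB⇒PTSC e v w) (DB⇒PTSC h (n' ∷ v) (𝒜-wf-ext (DB⇒PTSC g v w) n')) (λ p → _ , p , refl*) w)
    conv-T[u] : 𝒜 (sub θ (T [ u ])) C.↔* esub (𝒜 (sub θ u)) (𝒜 (sub θ U)) (𝒜 (body ν T))
    conv-T[u] = Eq.symmetric _ (subst (λ V → esub (𝒜 (sub θ u)) (𝒜 (sub θ U)) (𝒜 (body ν T)) C.↔* 𝒜 V) (sym (sub-[]-comm θ T u))
      (gmap (λ M → M) fwd (esub* (sub θ u) (𝒜 (sub θ U)) (body ν T))))
  DB⇒PTSC {ν = ν} (d-conv d e c) v w = C.t-conv (DB⇒PTSC d v w) (DB⇒PTSC e v w) (𝒜-conv (sub-conv (named ν) c))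

  name-ctxC : ∀ {Γ} → WfD Γ → ∃[ ν ] ∃[ Γ' ] (Naming Γ ν Γ' × C.Wf (𝒜ᶜ Γ'))
  name-ctxC []      = (λ i → i) , ε , [] , C.wf-ε
  name-ctxC (d ∷ w) with ν , Γ' , v , w' ← name-ctxC w with x , n ← fresh (dom Γ') =
    x ◂ ν , _ , n ∷ v , 𝒜-wf-ext (DB⇒PTSC d v w') n

  -- The names of `t` are replaced by indices, the indices by fresh names, and the result is
  -- encoded. The first two are substitutions, and all three reflect strong normalisation.
  PTSC⇒PTS : C.StronglyNormalising → P.StronglyNormalising
  PTSC⇒PTS sn Γ t T d with w , _ , d' ← pts-sem d with Δ , σ , wΔ , env ← generic-env w
    with ν , Γ' , v , w' ← name-ctxC wΔ =
    sub-SN⁻ σ (sub-SN⁻ (named ν) (𝒜-SN⁻ (sn _ _ _ (DB⇒PTSC (d' env) v w'))))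

  -- From normalisation of the PTS to that of the PTSC.

  module FromPTS (sn : P.StronglyNormalising) where

    DB-SN : ∀ {Δ t T} → WfD Δ → Δ ⊢ t ∶ T → P.SN t
    DB-SN w d with ν , Γ' , v , w' ← name-ctx w = sub-SN⁻ (named ν) (sn _ _ _ (DB⇒PTS d v w'))

    ℬ-SN : ∀ {Γ M A} → Γ C.⊢ M ∶ A → P.SN (ℬ M)
    ℬ-SN d with w , _ , d' ← ptsc-sem d with _ , σ , wΔ , env ← generic-env w = sub-SN⁻ σ (DB-SN wΔ (d' env))

    -- The arguments are applied to a new variable of the type the list expects, which makes them
    -- part of a typable term.
    ℬL-SN : ∀ {Γ A l B} → Γ C.∣ A ⊢ₗ l ∶ B → P.SN (apps (bvar 0) (ℬL l))
    ℬL-SN {A = A} {l} d with w , _ , cA , d' ← ptsc-semL d with Δ , σ , wΔ , env ← generic-env w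
      with (_ , dA) , _ ← d' env =
      sub-SN⁻ τ (subst P.SN (sym (sub-apps τ (bvar 0) (ℬL l)))
        (DB-SN (dA ∷ wΔ) (proj₂ (d' env-τ) (subst (_ ⊢ bvar 0 ∶_) A-τ (d-var here (weaken dA))))))
      where
      τ : Sub
      τ (nm x) = ren ↑h (σ (nm x))
      -- This keeps the head `bvar 0` in place as the new variable. The other indices collapse onto
      -- it too, which is harmless on types closed over the context.
      τ (bd i) = bvar 0
      env-τ : Env (sub σ (ℬ A) ∷ Δ) τ _
      env-τ p = subst (_ ⊢ _ ∶_) (∈-closed w p (agree λ _ → refl)) (env-wk env p)
      A-τ : ren ↑h (sub σ (ℬ A)) ≡ sub τ (ℬ A)
      A-τ = trans (ren-sub ↑h σ (ℬ A)) (cA (agree λ _ → refl))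

    -- The annotation of an explicit substitution occurs in the typing rules only as a type and as a
    -- declaration for the body; its normalisation is recovered from the body's context.
    AllSN : C.Ctx → Set
    AllSN Γ = ∀ {x A} → x C.⦂ A ∈ Γ → C.SN A

    mid-SN : ∀ {Γ x A} Δ → AllSN ((Γ ▸ x ⦂ A) C.⧺ Δ) → C.SN A
    mid-SN ε           f = f C.here
    mid-SN (Δ ▸ y ⦂ B) f = mid-SN Δ (f ∘ C.there)

    wf-SN : ∀ {Γ} → C.Wf Γ → AllSN Γ
    ⊢-SN  : ∀ {Γ M A} → Γ C.⊢ M ∶ A → AllSN Γ × C.SN M
    ⊢ₗ-SN : ∀ {Γ A l B} → Γ C.∣ A ⊢ₗ l ∶ B → AllSN Γ × SNL l

    opened-SN : ∀ x M → C.SN (C.openT x M) → C.SN M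
    opened-SN x M a = SN-unhren (openH x) (subst C.SN (openT-hren x M) a)

    wf-SN (C.wf-ext d n) C.here      = proj₂ (⊢-SN d)
    wf-SN (C.wf-ext d n) (C.there p) = proj₁ (⊢-SN d) p

    ⊢-SN (C.t-sort w a) = wf-SN w , SN-srt
    ⊢-SN (C.t-pi {B = B} {x} d n e r) = proj₁ (⊢-SN d) , SN-pi (proj₂ (⊢-SN d)) (opened-SN x B (proj₂ (⊢-SN e)))
    ⊢-SN (C.t-lam {M = M} {x} d n n' e) = proj₁ (⊢-SN d) ,
      -- The domain is normalising as a component of the product, which the first premise types.
      SN-lam (sn-subT (SN⇒SNE (proj₂ (⊢-SN d))) pi₁) (opened-SN x M (proj₂ (⊢-SN e)))
    ⊢-SN (C.t-var d p) = proj₁ (⊢ₗ-SN d) , SN-fvar (proj₂ (⊢ₗ-SN d))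
    ⊢-SN (C.t-conv d e c) = ⊢-SN d
    ⊢-SN d₀@(C.t-app d e) = proj₁ (⊢-SN d) , SN-app (ℬ-SN d₀) (proj₂ (⊢-SN d)) (proj₂ (⊢ₗ-SN e))
    ⊢-SN d₀@(C.t-esub {Δ = Δ} {x = x} {M} d e i w) = wf-SN w ,
      SN-esub (ℬ-SN d₀) (proj₂ (⊢-SN d)) (mid-SN Δ (proj₁ (⊢-SN e)))
        (subst C.SN (sym (closeT-hren x M)) (SN-hren (closeH x) (proj₂ (⊢-SN e))))

    ⊢ₗ-SN (C.l-nil d) = proj₁ (⊢-SN d) , SNL-nil
    ⊢ₗ-SN (C.l-cons d e f) = proj₁ (⊢-SN d) , SNL-cons (proj₂ (⊢-SN e)) (proj₂ (⊢ₗ-SN f))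
    ⊢ₗ-SN (C.l-convR d e c) = ⊢ₗ-SN d
    ⊢ₗ-SN (C.l-convL d e c) = ⊢ₗ-SN d
    ⊢ₗ-SN (C.l-cat d e) = proj₁ (⊢ₗ-SN d) , SNL-cat (proj₂ (⊢ₗ-SN d)) (proj₂ (⊢ₗ-SN e))
    ⊢ₗ-SN d₀@(C.l-sub {Δ = Δ} {x = x} {l = l} d e i w) = wf-SN w ,
      SN-lsub (bvar 0) (ℬL-SN d₀) (proj₂ (⊢-SN d)) (mid-SN Δ (proj₁ (⊢ₗ-SN e)))
        (subst SNL (sym (closeL-hren x l)) (SNL-hren (closeH x) (proj₂ (⊢ₗ-SN e))))

    ptsc-SN : C.StronglyNormalising
    ptsc-SN Γ M A d = proj₂ (⊢-SN d)

theorem4p5 : (S : Set) (Ax : S → S → Set) (Rl : S → S → S → Set) →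
    PTSC-SN S Ax Rl ⇔ PTS-SN S Ax Rl
theorem4p5 S Ax Rl = mk⇔ PTSC⇒PTS FromPTS.ptsc-SN
  where open Equivalence S Ax Rl
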